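{- There exists an oracle $O\subseteq\Sigma^*$ such that, relative to $O$: (i) $\overline{\mathrm{C}^O}$ has a p-optimal proof system, and (ii) $\overline{\mathrm{D}^O}$ has no optimal proof system.
   Context: $\Sigma=\{0,1\}$, words identified with naturals via a polynomial-time bijection. Let $\langle\cdot\rangle$ be an injective, polynomial-time computable and invertible tupling function with $|\langle u_1,\dots,u_n\rangle|=2(|u_1|+\dots+|u_n|+n)$, and $p_i(x)=x^i+i$. Let $\{N_i\}_{i\in\mathbb{N}}$ be a standard enumeration of nondeterministic polynomial-time oracle Turing machines, $N_i$ having running time bounded by $p_i$, with $N_0$ always rejecting and $N_1$ always accepting. $L^p(N_i^O)$ is the set of inputs accepted by $N_i^O$ within $p$ steps. Define $\mathrm{C}^O=\{\langle 0^i,x,0^p\rangle \mid x\in L^p(N_i^O)\}$ and $\mathrm{D}^O=\{\langle 0^i,0^j,x,0^p\rangle \mid x\in L^p(N_i^O)\cap\overline{L^p(N_j^O)}\}$ (these are $\mathrm{NP}^O$-complete resp. $\mathrm{DP}^O$-complete). Relative to $O$: a proof system for $L$ is a total function computable in polynomial time by an oracle transducer with oracle $O$ whose image is $L$; $g$ is simulated (resp. p-simulated) by $f$ if there is a total function $\pi$ (resp. $\pi\in\mathrm{FP}^O$) and a polynomial $p$ with $|\pi(x)|\le p(|x|)$ and $f(\pi(x))=g(x)$ for all $x$; $f$ is optimal (resp. p-optimal) for $L$ if it simulates (resp. p-simulates) every proof system for $L$. -}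

module Defs where

open import Data.Bool using (Bool; true; false; if_then_else_; _∨_; _∧_)
open import Data.Nat using (ℕ; zero; suc; _+_; _*_; _∸_; _^_; _≤_; _⊓_; _≡ᵇ_)
open import Data.List using (List; []; _∷_; _++_; length; reverse; map; concatMap; replicate)
open import Data.Bool.ListAction using (any)
open import Data.Maybe using (Maybe; just; nothing; _>>=_)
open import Data.Product using (Σ; _×_; _,_; ∃; ∃-syntax)
open import Relation.Binary.PropositionalEquality using (_≡_)
open import Relation.Nullary using (¬_)

-- Words over Σ = {0,1}  (false = 0, true = 1)

Word : Set
Word = List Bool

∣_∣ : Word → ℕ
∣ x ∣ = length x

0^ : ℕ → Word
0^ n = replicate n false

Oracle : Set
Oracle = Word → Bool

-- Tupling function: ⟨u₁,…,uₙ⟩ = d(u₁)01 d(u₂)01 … d(uₙ)01, where d doubles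
-- every bit.  Injective, polynomial-time computable and invertible, and
-- |⟨u₁,…,uₙ⟩| = 2(|u₁|+…+|uₙ|+n).

dbl : Word → Word
dbl = concatMap (λ b → b ∷ b ∷ [])

⟨_⟩ : List Word → Word
⟨ us ⟩ = concatMap (λ u → dbl u ++ (false ∷ true ∷ [])) us

Poly : Set
Poly = List ℕ

eval : Poly → ℕ → ℕ
eval []       n = 0
eval (c ∷ cs) n = c + n * eval cs n

pᵢ : ℕ → ℕ → ℕ
pᵢ i x = x ^ i + i

-- Oracle Turing machines.
-- One two-way work tape (semi-infinite to the left, initially holding the
-- input), and one write-only query tape.  Tape symbols are naturals:
-- 0 = blank, 1 = bit 0, 2 = bit 1.
-- States are naturals: 0 = start, 1 = accept (halt), 2 = reject (halt),
-- 3 = query state, 4 = answer "yes", 5 = answer "no".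
-- In the query state the machine moves (in one step) to state 4 if the
-- content of the query tape is in the oracle and to 5 otherwise, and the
-- query tape is erased.

data Move : Set where
  L R S : Move

record Rule : Set where
  constructor rule
  field
    from   : ℕ
    read   : ℕ
    to     : ℕ
    write  : ℕ
    move   : Move
    qwrite : Maybe Bool

Machine : Set
Machine = List Rule

record Config : Set where
  constructor config
  field
    state : ℕ
    left  : List ℕ      -- cells left of the head, nearest first
    head  : ℕ
    right : List ℕ
    query : List Bool   -- query tape content, reversed

open Config public

sym : Bool → ℕ
sym false = 1
sym true  = 2

initConfig : Word → Config
initConfig []       = config 0 [] 0 [] []
initConfig (b ∷ bs) = config 0 [] (sym b) (map sym bs) []

doMove : Move → List ℕ → ℕ → List ℕ → (List ℕ × ℕ × List ℕ)
doMove L []      h r       = [] , h , r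
doMove L (a ∷ l) h r       = l , a , h ∷ r
doMove R l       h []      = h ∷ l , 0 , []
doMove R l       h (a ∷ r) = h ∷ l , a , r
doMove S l       h r       = l , h , r

addQ : Maybe Bool → List Bool → List Bool
addQ nothing  q = q
addQ (just b) q = b ∷ q

applyRule : Rule → Config → Config
applyRule (rule _ _ s' w m qw) (config _ l _ r q) with doMove m l w r
... | l' , h' , r' = config s' l' h' r' (addQ qw q)

matches : Rule → Config → Bool
matches (rule s a _ _ _ _) c = (s ≡ᵇ state c) ∧ (a ≡ᵇ head c)

special : ℕ → Bool
special s = (s ≡ᵇ 1) ∨ ((s ≡ᵇ 2) ∨ (s ≡ᵇ 3))

queryStep : Oracle → Config → Config
queryStep O (config _ l h r q) =
  config (if O (reverse q) then 4 else 5) l h r []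

succs : Oracle → Machine → Config → List Config
succs O M c =
  if state c ≡ᵇ 3 then queryStep O c ∷ []
  else if special (state c) then []
  else go M
  where
  go : Machine → List Config
  go []       = []
  go (ρ ∷ ρs) = if matches ρ c then applyRule ρ c ∷ go ρs else go ρs

stepD : Oracle → Machine → Config → Maybe Config
stepD O M c =
  if state c ≡ᵇ 3 then just (queryStep O c)
  else if special (state c) then nothing
  else go M
  where
  go : Machine → Maybe Config
  go []       = nothing
  go (ρ ∷ ρs) = if matches ρ c then just (applyRule ρ c) else go ρs

accWithin : Oracle → Machine → ℕ → Config → Bool
accWithin O M zero    c = state c ≡ᵇ 1
accWithin O M (suc t) c = (state c ≡ᵇ 1) ∨ any (accWithin O M t) (succs O M c)

runD : Oracle → Machine → ℕ → Config → Maybe Config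
runD O M zero    c = if state c ≡ᵇ 1 then just c else nothing
runD O M (suc t) c =
  if state c ≡ᵇ 1 then just c else (stepD O M c >>= runD O M t)

takeBits : List ℕ → Word
takeBits []            = []
takeBits (zero ∷ _)    = []
takeBits (suc zero ∷ xs) = false ∷ takeBits xs
takeBits (suc (suc zero) ∷ xs) = true ∷ takeBits xs
takeBits (suc (suc (suc _)) ∷ _) = []

output : Config → Word
output c = takeBits (head c ∷ right c)

ComputesIn : Oracle → Machine → Poly → (Word → Word) → Set
ComputesIn O M q f =
  ∀ x → Σ Config λ c → (runD O M (eval q ∣ x ∣) (initConfig x) ≡ just c)
                       × (output c ≡ f x)

FP : Oracle → (Word → Word) → Set
FP O f = Σ Machine λ M → Σ Poly λ q → ComputesIn O M q f

-- Cantor enumeration of ℕ × ℕ (a bijection ℕ → ℕ × ℕ)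
unpair : ℕ → ℕ × ℕ
unpair zero = 0 , 0
unpair (suc n) with unpair n
... | zero  , b = suc b , 0
... | suc a , b = a , suc b

decodeList′ : ℕ → ℕ → List ℕ
decodeList′ zero      _       = []
decodeList′ (suc f)   zero    = []
decodeList′ (suc f)   (suc n) with unpair n
... | a , b = a ∷ decodeList′ f b

decodeList : ℕ → List ℕ
decodeList n = decodeList′ n n

decodeMove : ℕ → Move
decodeMove zero          = L
decodeMove (suc zero)    = R
decodeMove (suc (suc _)) = S

decodeQ : ℕ → Maybe Bool
decodeQ zero          = nothing
decodeQ (suc zero)    = just false
decodeQ (suc (suc _)) = just true

decodeRule : ℕ → Rule
decodeRule n with unpair n
... | s , n₁ with unpair n₁
... | a , n₂ with unpair n₂
... | s' , n₃ with unpair n₃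
... | w , n₄ with unpair n₄
... | m , qw = rule s a s' w (decodeMove m) (decodeQ qw)

-- N₀ always rejects (no rules), N₁ always accepts (goes to the accepting
-- state on every symbol read in the first step), N_{i+2} is the i-th machine.
-- N_i is clocked by p_i.
acceptAll : Machine
acceptAll = rule 0 0 1 0 S nothing ∷ rule 0 1 1 1 S nothing ∷ rule 0 2 1 2 S nothing ∷ []

N : ℕ → Machine
N zero          = []
N (suc zero)    = acceptAll
N (suc (suc i)) = map decodeRule (decodeList i)

-- x ∈ L^p(N_i^O): N_i^O accepts x within p steps (N_i being clocked by p_i)
InLp : Oracle → ℕ → ℕ → Word → Set
InLp O i p x = accWithin O (N i) (p ⊓ pᵢ i ∣ x ∣) (initConfig x) ≡ true

C : Oracle → Word → Set
C O w = ∃[ i ] ∃[ x ] ∃[ p ] (w ≡ ⟨ 0^ i ∷ x ∷ 0^ p ∷ [] ⟩) × InLp O i p x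

D : Oracle → Word → Set
D O w = ∃[ i ] ∃[ j ] ∃[ x ] ∃[ p ]
  (w ≡ ⟨ 0^ i ∷ 0^ j ∷ x ∷ 0^ p ∷ [] ⟩) × InLp O i p x × ¬ InLp O j p x

co : (Word → Set) → (Word → Set)
co A w = ¬ A w

ProofSystem : Oracle → (Word → Set) → (Word → Word) → Set
ProofSystem O A f = FP O f × (∀ y → (A y → ∃[ x ] f x ≡ y) × (∃[ x ] f x ≡ y → A y))

Simulates : (Word → Word) → (Word → Word) → Set
Simulates f g = Σ (Word → Word) λ π → Σ Poly λ q →
  ∀ x → (∣ π x ∣ ≤ eval q ∣ x ∣) × (f (π x) ≡ g x)

PSimulates : Oracle → (Word → Word) → (Word → Word) → Set
PSimulates O f g = Σ (Word → Word) λ π → FP O π × (Σ Poly λ q →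
  ∀ x → (∣ π x ∣ ≤ eval q ∣ x ∣) × (f (π x) ≡ g x))

Optimal : Oracle → (Word → Set) → (Word → Word) → Set
Optimal O A f = ProofSystem O A f × (∀ g → ProofSystem O A g → Simulates f g)

POptimal : Oracle → (Word → Set) → (Word → Word) → Set
POptimal O A f = ProofSystem O A f × (∀ g → ProofSystem O A g → PSimulates O f g)

{-# OPTIONS --safe #-}
-- The oracle stores, bit by bit, functions that a fixed kind of machine can read
-- off, and it contains free witnesses. The stored function hf decodes the values
-- of every transducer that has not yet been caught producing an element of C, so
-- it is a p-optimal proof system for the complement of C by construction.
--
-- At stage s only the witnesses of one length are undecided, and hard s lies in D
-- iff some witness tagged 0 but none tagged 1 is present. The proof system hg k
-- has short proofs of hard s for all s whose target is transducer k. If some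
-- transducer can be caught by choosing no witness, or a pair with both tags, this
-- is done; hard s then stays outside D. Otherwise all those choices leave hf
-- unchanged in its trust, so that reading hf amounts to deterministic computation
-- and a computation depends on few witnesses. A single witness tagged 0 then leaves
-- the trust unchanged too, since a computation catching a transducer would overlook
-- some witness tagged 1, which could be added to form a pair: this step is what
-- needs D instead of C. Hence a short proof of hard s by transducer k survives the
-- addition of a witness tagged 0 that it overlooks, which moves hard s into D and
-- makes k unsound. Catching cannot go on forever: a block of stages has more
-- stages than transducers that can be caught in it.
module Submission where

-- Two rates of growth have to fit. The witnesses of stage `s` have about `tower s` bits, so a
-- polynomial simulation of a short proof of `hard s` takes at most `tower (suc s)` steps for late
-- `s`, which is within `horizon s`. A computation of that length must still overlook a witness,
-- although there are only 32 times `tower (suc s)` of them with each tag. Hence the accounting has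
-- to be linear: a computation may depend on no more witnesses than its length, however deeply the
-- readings of `hf` are nested. This works because the total length of the queries is what is
-- bounded, and a code for `hf` writes in unary the time of the computation it stands for, so it is
-- longer than all the queries of that computation together. The obstacle is the trust: whether a
-- transducer has been caught is a search over exponentially many codes and could depend on every
-- witness. Computations are therefore compared only between settings in which the trust is still
-- what it was before the stage, where the oracle is the same for all settings.

open import Defs
open import Data.Bool using (Bool; true; false; if_then_else_; _∨_; _∧_; not; T)
open import Data.Bool.Properties using (∨-identityʳ) renaming (_≟_ to _≟ᵇ_)
open import Data.Bool.ListAction using (any)
open import Data.Nat
open import Data.Nat.Properties
open import Data.Nat.ListAction using (sum)
open import Data.Nat.ListAction.Properties using (sum-++)
open import Data.List using (List; []; _∷_; _++_; length; reverse; map; replicate; drop; filter; cartesianProductWith; _ʳ++_)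
open import Data.List.Properties using (length-++; length-reverse; reverse-involutive; unfold-reverse; ʳ++-ʳ++; map-ʳ++; length-map; length-replicate; map-++; ++-assoc; ++-identityʳ; map-replicate; ∷-injective; ≡-dec)
open import Data.List.Relation.Unary.All using (All; []; _∷_)
import Data.List.Relation.Unary.All as All
import Data.List.Relation.Unary.All.Properties as All
open import Data.List.Relation.Unary.Any using (here; there)
open import Data.List.Membership.Propositional using (_∈_)
open import Data.List.Membership.Propositional.Properties using (∈-++⁺ˡ; ∈-++⁺ʳ; ∈-++⁻; ∈-map⁺; ∈-map⁻; ∈-filter⁺; ∈-filter⁻; ∈-cartesianProductWith⁺; ∈-cartesianProductWith⁻)
open import Data.Maybe as Maybe using (Maybe; just; nothing; fromMaybe; _>>=_)
open import Data.Maybe.Properties using (just-injective)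
open import Data.Product using (_×_; _,_; ∃-syntax; proj₁; proj₂)
open import Data.Sum using (_⊎_; inj₁; inj₂)
open import Data.Empty using (⊥; ⊥-elim)
open import Relation.Binary.PropositionalEquality as ≡ using (_≡_; _≢_; refl; cong; cong₂; subst; trans)
open import Relation.Nullary using (¬_; Dec; yes; no)
open import Relation.Nullary.Decidable using (⌊_⌋)
open import Data.Nat.Solver using (module +-*-Solver)
open +-*-Solver using (solve; _:+_; _:*_; con; _:=_)

-- Computations and the queries they depend on

-- The search through the rules inside stepD and succs is a local function
-- without a name. Unification recovers it: abstracting the whole machine in
-- the goal separates it from the list of rules still to be searched.
mutual
  goD : Oracle → Machine → Config → Machine → Maybe Config
  goD = _

  goS : Oracle → Machine → Config → Machine → List Config
  goS = _

  goD-solution : ∀ O c ρ ρs → (state c ≡ᵇ 3) ≡ false → special (state c) ≡ false → matches ρ c ≡ false →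
    stepD O (ρ ∷ ρs) c ≡ goD O (ρ ∷ ρs) c ρs
  goD-solution O c ρ ρs e₁ e₂ e₃ rewrite e₁ | e₂ | e₃ with ρ ∷ ρs
  ... | _ = refl

  goS-solution : ∀ O c ρ ρs → (state c ≡ᵇ 3) ≡ false → special (state c) ≡ false → matches ρ c ≡ false →
    succs O (ρ ∷ ρs) c ≡ goS O (ρ ∷ ρs) c ρs
  goS-solution O c ρ ρs e₁ e₂ e₃ rewrite e₁ | e₂ | e₃ with ρ ∷ ρs
  ... | _ = refl

fire : Machine → Config → Maybe Config
fire []       c = nothing
fire (ρ ∷ ρs) c = if matches ρ c then just (applyRule ρ c) else fire ρs c

branches : Machine → Config → List Config
branches []       c = []
branches (ρ ∷ ρs) c = if matches ρ c then applyRule ρ c ∷ branches ρs c else branches ρs c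

goD-fire : ∀ O K c ρs → goD O K c ρs ≡ fire ρs c
goD-fire O K c []       = refl
goD-fire O K c (ρ ∷ ρs) with matches ρ c
... | true  = refl
... | false = goD-fire O K c ρs

goS-branches : ∀ O K c ρs → goS O K c ρs ≡ branches ρs c
goS-branches O K c []       = refl
goS-branches O K c (ρ ∷ ρs) with matches ρ c
... | true  = cong (applyRule ρ c ∷_) (goS-branches O K c ρs)
... | false = goS-branches O K c ρs

tape : Config → ℕ
tape c = length (left c) + length (right c)

record Grows (c c' : Config) : Set where
  constructor grows
  field
    grows-query : ∣ query c' ∣ ≤ suc ∣ query c ∣
    grows-tape  : tape c' ≤ suc (tape c)
open Grows

addQ-grows : ∀ m q → ∣ addQ m q ∣ ≤ suc ∣ q ∣
addQ-grows nothing  q = n≤1+n _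
addQ-grows (just x) q = ≤-refl

applyRule-grows : ∀ ρ c → Grows c (applyRule ρ c)
applyRule-grows (rule _ _ _ _ L m) (config _ []      _ r q)       = grows (addQ-grows m q) (n≤1+n _)
applyRule-grows (rule _ _ _ _ L m) (config _ (a ∷ l) _ r q)       =
  grows (addQ-grows m q) (≤-trans (≤-reflexive (+-suc _ _)) (n≤1+n _))
applyRule-grows (rule _ _ _ _ R m) (config _ l       _ [] q)      = grows (addQ-grows m q) ≤-refl
applyRule-grows (rule _ _ _ _ R m) (config _ l       _ (a ∷ r) q) =
  grows (addQ-grows m q) (≤-trans (s≤s (+-monoʳ-≤ (length l) (n≤1+n _))) ≤-refl)
applyRule-grows (rule _ _ _ _ S m) (config _ l       _ r q)       = grows (addQ-grows m q) (n≤1+n _)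

fire-grows : ∀ M c {c'} → fire M c ≡ just c' → Grows c c'
fire-grows (ρ ∷ M) c e with matches ρ c
... | false = fire-grows M c e
fire-grows (ρ ∷ M) c refl | true = applyRule-grows ρ c

branches-grow : ∀ M c {c'} → c' ∈ branches M c → Grows c c'
branches-grow (ρ ∷ M) c e with matches ρ c
... | false = branches-grow M c e
branches-grow (ρ ∷ M) c (here refl) | true = applyRule-grows ρ c
branches-grow (ρ ∷ M) c (there e)   | true = branches-grow M c e

-- The cases isolate the only place where the oracle enters, the query state. A `moving`
-- configuration has the same successors under every oracle. One view serves deterministic and
-- nondeterministic runs alike.
data Behaviour (M : Machine) (c : Config) : Set where
  accepting :
    (∀ O t → runD O M t c ≡ just c) →
    (∀ O t → accWithin O M t c ≡ true) →
    Behaviour M c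
  asking :
    (∀ O → runD O M 0 c ≡ nothing) →
    (∀ O t → runD O M (suc t) c ≡ runD O M t (queryStep O c)) →
    (∀ O → accWithin O M 0 c ≡ false) →
    (∀ O t → accWithin O M (suc t) c ≡ any (accWithin O M t) (queryStep O c ∷ [])) →
    Behaviour M c
  moving : (next : Maybe Config) (nexts : List Config) →
    (∀ {c'} → next ≡ just c' → Grows c c') →
    (∀ {c'} → c' ∈ nexts → Grows c c') →
    (∀ O → runD O M 0 c ≡ nothing) →
    (∀ O t → runD O M (suc t) c ≡ (next >>= runD O M t)) →
    (∀ O → accWithin O M 0 c ≡ false) →
    (∀ O t → accWithin O M (suc t) c ≡ any (accWithin O M t) nexts) →
    Behaviour M c

behaviour : ∀ M c → Behaviour M c
behaviour M (config 1 l h r q) = accepting (λ { O zero → refl ; O (suc t) → refl }) (λ { O zero → refl ; O (suc t) → refl })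
behaviour M (config 2 l h r q) =
  moving nothing [] (λ ()) (λ ()) (λ O → refl) (λ O t → refl) (λ O → refl) (λ O t → refl)
behaviour M (config 3 l h r q) = asking (λ O → refl) (λ O t → refl) (λ O → refl) (λ O t → refl)
behaviour M (config 0 l h r q) =
  moving (fire M _) (branches M _) (fire-grows M _) (branches-grow M _)
    (λ O → refl) (λ O t → cong (_>>= runD O M t) (goD-fire O M _ M))
    (λ O → refl) (λ O t → cong (any (accWithin O M t)) (goS-branches O M _ M))
behaviour M (config (suc (suc (suc (suc s)))) l h r q) =
  moving (fire M _) (branches M _) (fire-grows M _) (branches-grow M _)
    (λ O → refl) (λ O t → cong (_>>= runD O M t) (goD-fire O M _ M))
    (λ O → refl) (λ O t → cong (any (accWithin O M t)) (goS-branches O M _ M))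

runD-tape : ∀ O M t c {c'} → runD O M t c ≡ just c' → tape c' ≤ tape c + t
runD-tape O M t c e with behaviour M c
runD-tape O M t c e | accepting r _ with refl ← just-injective (trans (≡.sym (r O t)) e) = m≤m+n _ t
runD-tape O M zero c e | asking r₀ _ _ _ with () ← trans (≡.sym (r₀ O)) e
runD-tape O M (suc t) c e | asking _ r _ _ =
  ≤-trans (runD-tape O M t _ (trans (≡.sym (r O t)) e)) (+-monoʳ-≤ (tape c) (n≤1+n t))
runD-tape O M zero c e | moving _ _ _ _ r₀ _ _ _ with () ← trans (≡.sym (r₀ O)) e
runD-tape O M (suc t) c e | moving nothing _ _ _ _ r _ _ with () ← trans (≡.sym (r O t)) e
runD-tape O M (suc t) c e | moving (just c₁) _ g _ _ r _ _ =
  ≤-trans (runD-tape O M t c₁ (trans (≡.sym (r O t)) e))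
    (≤-trans (+-monoˡ-≤ t (grows-tape (g refl))) (≤-reflexive (≡.sym (+-suc _ t))))

runD-suc : ∀ O M t c {c'} → runD O M t c ≡ just c' → runD O M (suc t) c ≡ just c'
runD-suc O M t c e with behaviour M c
runD-suc O M t c e | accepting r _ = trans (r O (suc t)) (trans (≡.sym (r O t)) e)
runD-suc O M zero c e | asking r₀ _ _ _ with () ← trans (≡.sym (r₀ O)) e
runD-suc O M (suc t) c e | asking _ r _ _ =
  trans (r O (suc t)) (runD-suc O M t _ (trans (≡.sym (r O t)) e))
runD-suc O M zero c e | moving _ _ _ _ r₀ _ _ _ with () ← trans (≡.sym (r₀ O)) e
runD-suc O M (suc t) c e | moving nothing _ _ _ _ r _ _ with () ← trans (≡.sym (r O t)) e
runD-suc O M (suc t) c e | moving (just c₁) _ _ _ _ r _ _ =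
  trans (r O (suc t)) (runD-suc O M t c₁ (trans (≡.sym (r O t)) e))

runD-mono : ∀ O M {t t'} c {c'} → t ≤ t' → runD O M t c ≡ just c' → runD O M t' c ≡ just c'
runD-mono O M {t} c t≤t' e = go (≤⇒≤′ t≤t')
  where
  go : ∀ {t'} → t ≤′ t' → runD O M t' c ≡ just _
  go ≤′-refl     = e
  go (≤′-step {t'} p) = runD-suc O M t' c (go p)

runD-unique : ∀ O M t t' c {c₁ c₂} → runD O M t c ≡ just c₁ → runD O M t' c ≡ just c₂ → c₁ ≡ c₂
runD-unique O M t t' c e₁ e₂ =
  just-injective (trans (≡.sym (runD-mono O M c (m≤m+n t t') e₁)) (runD-mono O M c (m≤n+m t' t) e₂))

output-tape : ∀ c → ∣ output c ∣ ≤ suc (tape c)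
output-tape c = ≤-trans (takeBits-length (head c ∷ right c)) (s≤s (m≤n+m _ _))
  where
  takeBits-length : ∀ xs → ∣ takeBits xs ∣ ≤ length xs
  takeBits-length []       = z≤n
  takeBits-length (0 ∷ xs) = z≤n
  takeBits-length (1 ∷ xs) = s≤s (takeBits-length xs)
  takeBits-length (2 ∷ xs) = s≤s (takeBits-length xs)
  takeBits-length (suc (suc (suc _)) ∷ xs) = z≤n

initConfig-tape : ∀ x → tape (initConfig x) ≤ ∣ x ∣
initConfig-tape []       = z≤n
initConfig-tape (b ∷ x)  = ≤-trans (≤-reflexive (length-map sym x)) (n≤1+n _)

initConfig-query : ∀ x → query (initConfig x) ≡ []
initConfig-query []      = refl
initConfig-query (b ∷ x) = refl

any-mono : ∀ {A : Set} (p p' : A → Bool) xs → (∀ {x} → x ∈ xs → p x ≡ true → p' x ≡ true) →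
  any p xs ≡ true → any p' xs ≡ true
any-mono p p' (x ∷ xs) f e with p x in px
... | true rewrite f (here refl) px = refl
... | false with p' x
... | true  = refl
... | false = any-mono p p' xs (λ i → f (there i)) e

any-∈ : ∀ {A : Set} (p : A → Bool) {x} xs → x ∈ xs → p x ≡ true → any p xs ≡ true
any-∈ p (x ∷ xs) (here refl) e rewrite e = refl
any-∈ p (x ∷ xs) (there i) e with p x
... | true  = refl
... | false = any-∈ p xs i e

∈-any : ∀ {A : Set} (p : A → Bool) xs → any p xs ≡ true → ∃[ x ] x ∈ xs × p x ≡ true
∈-any p (x ∷ xs) e with p x in px
... | true  = x , here refl , px
... | false with ∈-any p xs e
... | y , i , py = y , there i , py

accWithin-suc : ∀ O M t c → accWithin O M t c ≡ true → accWithin O M (suc t) c ≡ true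
accWithin-suc O M zero c e rewrite e = refl
accWithin-suc O M (suc t) c e with behaviour M c
... | accepting _ a = a O (suc (suc t))
... | asking _ _ _ a =
  trans (a O (suc t)) (any-mono (accWithin O M t) (accWithin O M (suc t)) (queryStep O c ∷ []) (λ {x} _ → accWithin-suc O M t x) (trans (≡.sym (a O t)) e))
... | moving _ nexts _ _ _ _ _ a =
  trans (a O (suc t)) (any-mono (accWithin O M t) (accWithin O M (suc t)) nexts (λ {x} _ → accWithin-suc O M t x) (trans (≡.sym (a O t)) e))

accWithin-mono : ∀ O M {t t'} c → t ≤ t' → accWithin O M t c ≡ true → accWithin O M t' c ≡ true
accWithin-mono O M {t} c t≤t' e = go (≤⇒≤′ t≤t')
  where
  go : ∀ {t'} → t ≤′ t' → accWithin O M t' c ≡ true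
  go ≤′-refl     = e
  go (≤′-step {t'} p) = accWithin-suc O M t' c (go p)

-- The budget `n` bounds the total length of the queries instead of their number: a query of length
-- `m` will turn out to depend on at most `m` witnesses, so the total bounds the witnesses seen by
-- the whole computation.
record Uses (ℓ n : ℕ) (O : Oracle) (P : Oracle → Set) : Set where
  constructor uses
  field
    asked : List Word
    short : All (λ v → ∣ v ∣ < ℓ) asked
    total : sum (map length asked) ≤ n
    holds : ∀ O' → All (λ v → O' v ≡ O v) asked → P O'

uses-weaken : ∀ {ℓ ℓ' n n' O P} → ℓ ≤ ℓ' → n ≤ n' → Uses ℓ n O P → Uses ℓ' n' O P
uses-weaken ℓ≤ n≤ (uses vs s t h) = uses vs (All.map (λ v< → ≤-trans v< ℓ≤) s) (≤-trans t n≤) h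

uses-map : ∀ {ℓ n O P P'} → (∀ O' → P O' → P' O') → Uses ℓ n O P → Uses ℓ n O P'
uses-map f (uses vs s t h) = uses vs s t (λ O' a → f O' (h O' a))

uses-× : ∀ {ℓ n n' O P P'} → Uses ℓ n O P → Uses ℓ n' O P' → Uses ℓ (n + n') O (λ O' → P O' × P' O')
uses-× {n = n} {n'} (uses vs s t h) (uses vs' s' t' h') =
  uses (vs ++ vs') (All.++⁺ s s')
    (≤-trans (≤-reflexive (trans (cong sum (map-++ length vs vs')) (sum-++ (map length vs) _))) (+-mono-≤ t t'))
    (λ O' a → h O' (All.++⁻ˡ vs a) , h' O' (All.++⁻ʳ vs a))

uses-local : ∀ {ℓ n O P} → Uses ℓ n O P → ∀ O' → (∀ v → ∣ v ∣ < ℓ → O' v ≡ O v) → P O'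
uses-local (uses vs s t h) O' a = h O' (All.map (λ {v} → a v) s)

uses-query : ∀ {t O P P'} c → Uses (suc t) t O P →
  (∀ O' → O' (reverse (query c)) ≡ O (reverse (query c)) → P O' → P' O') →
  Uses (suc (∣ query c ∣ + suc t)) (∣ query c ∣ + suc t) O P'
uses-query {t} c (uses vs s tot h) f = uses (reverse (query c) ∷ vs)
  (s≤s (≤-trans (≤-reflexive (length-reverse (query c))) (m≤m+n _ _))
    ∷ All.map (λ v< → ≤-trans v< (s≤s (≤-trans (n≤1+n t) (m≤n+m (suc t) _)))) s)
  (+-mono-≤ (≤-reflexive (length-reverse (query c))) (≤-trans tot (n≤1+n t)))
  λ { O' (a ∷ as) → f O' a (h O' as) }

queryStep-agree : ∀ O O' c → O' (reverse (query c)) ≡ O (reverse (query c)) → queryStep O' c ≡ queryStep O c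
queryStep-agree O O' c e rewrite e = refl

-- The content of the query tape plus the remaining time is a potential that never grows: a step
-- adds at most one symbol, and a query spends the content, since the tape is erased.
runD-uses : ∀ O M t c → Uses (suc (∣ query c ∣ + t)) (∣ query c ∣ + t) O (λ O' → runD O' M t c ≡ runD O M t c)
runD-uses O M t c with behaviour M c
runD-uses O M t c | accepting r _ = uses [] [] z≤n λ O' _ → trans (r O' t) (≡.sym (r O t))
runD-uses O M zero c | asking r₀ _ _ _ = uses [] [] z≤n λ O' _ → trans (r₀ O') (≡.sym (r₀ O))
runD-uses O M (suc t) c | asking _ r _ _ =
  uses-query c (runD-uses O M t (queryStep O c)) λ O' a e →
    trans (r O' t) (trans (cong (runD O' M t) (queryStep-agree O O' c a)) (trans e (≡.sym (r O t))))
runD-uses O M zero c | moving _ _ _ _ r₀ _ _ _ = uses [] [] z≤n λ O' _ → trans (r₀ O') (≡.sym (r₀ O))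
runD-uses O M (suc t) c | moving nothing _ _ _ _ r _ _ = uses [] [] z≤n λ O' _ → trans (r O' t) (≡.sym (r O t))
runD-uses O M (suc t) c | moving (just c₁) _ g _ _ r _ _ =
  uses-weaken (s≤s bound) bound
    (uses-map (λ O' e → trans (r O' t) (trans e (≡.sym (r O t)))) (runD-uses O M t c₁))
  where
  bound : ∣ query c₁ ∣ + t ≤ ∣ query c ∣ + suc t
  bound = ≤-trans (+-monoˡ-≤ t (grows-query (g refl))) (≤-reflexive (≡.sym (+-suc _ t)))

-- A single accepting branch is a certificate, so the bound is that of one run. Rejection has no
-- such certificate, and for this reason the conclusion concerns acceptance only.
accWithin-uses : ∀ O M t c → accWithin O M t c ≡ true →
  Uses (suc (∣ query c ∣ + t)) (∣ query c ∣ + t) O (λ O' → accWithin O' M t c ≡ true)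
accWithin-uses O M t c e with behaviour M c
accWithin-uses O M t c e | accepting _ a = uses [] [] z≤n λ O' _ → a O' t
accWithin-uses O M zero c e | asking _ _ a₀ _ with () ← trans (≡.sym (a₀ O)) e
accWithin-uses O M (suc t) c e | asking _ _ _ a with ∈-any (accWithin O M t) (queryStep O c ∷ []) (trans (≡.sym (a O t)) e)
... | _ , here refl , e₁ =
  uses-query c (accWithin-uses O M t (queryStep O c) e₁) λ O' ag e' →
    trans (a O' t) (any-∈ (accWithin O' M t) (queryStep O' c ∷ []) (here refl) (trans (cong (accWithin O' M t) (queryStep-agree O O' c ag)) e'))
accWithin-uses O M zero c e | moving _ _ _ _ _ _ a₀ _ with () ← trans (≡.sym (a₀ O)) e
accWithin-uses O M (suc t) c e | moving _ nexts _ g _ _ _ a with ∈-any (accWithin O M t) nexts (trans (≡.sym (a O t)) e)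
... | c₁ , i , e₁ =
  uses-weaken (s≤s bound) bound
    (uses-map (λ O' e' → trans (a O' t) (any-∈ (accWithin O' M t) nexts i e')) (accWithin-uses O M t c₁ e₁))
  where
  bound : ∣ query c₁ ∣ + t ≤ ∣ query c ∣ + suc t
  bound = ≤-trans (+-monoˡ-≤ t (grows-query (g i))) (≤-reflexive (≡.sym (+-suc _ t)))

-- Codes of machines and tuples

unpair-suc : ∀ n a b → unpair n ≡ (suc a , b) → unpair (suc n) ≡ (a , suc b)
unpair-suc n a b e rewrite e = refl

unpair-zero : ∀ n b → unpair n ≡ (0 , b) → unpair (suc n) ≡ (suc b , 0)
unpair-zero n b e rewrite e = refl

unpair-sum : ∀ n → proj₁ (unpair n) + proj₂ (unpair n) ≤ n
unpair-sum zero = z≤n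
unpair-sum (suc n) with unpair n | unpair-sum n
... | zero  , b | p = s≤s (≤-trans (≤-reflexive (+-identityʳ b)) p)
... | suc a , b | p = ≤-trans (≤-reflexive (+-suc a b)) (≤-trans p (n≤1+n n))

unpair-diagonal : ∀ n a b → unpair n ≡ (a + b , 0) → unpair (b + n) ≡ (a , b)
unpair-diagonal n a zero    e = trans e (cong (_, 0) (+-identityʳ a))
unpair-diagonal n a (suc b) e =
  unpair-suc (b + n) a b (unpair-diagonal n (suc a) b (trans e (cong (_, 0) (+-suc a b))))

diagonal-start : ∀ d → ∃[ n ] unpair n ≡ (d , 0)
diagonal-start zero    = 0 , refl
diagonal-start (suc d) with diagonal-start d
... | n , e = suc (d + n) , unpair-zero (d + n) d (unpair-diagonal n 0 d e)

pair : ℕ → ℕ → ℕ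
pair a b = b + proj₁ (diagonal-start (a + b))

unpair-pair : ∀ a b → unpair (pair a b) ≡ (a , b)
unpair-pair a b = unpair-diagonal _ a b (proj₂ (diagonal-start (a + b)))

snd≤pair : ∀ a b → b ≤ pair a b
snd≤pair a b = m≤m+n b _

decodeList-cons : ∀ f n a b → unpair n ≡ (a , b) → decodeList′ (suc f) (suc n) ≡ a ∷ decodeList′ f b
decodeList-cons f n a b e rewrite e = refl

encodeList : List ℕ → ℕ
encodeList []       = 0
encodeList (a ∷ as) = suc (pair a (encodeList as))

decodeList-encodeList : ∀ as → decodeList (encodeList as) ≡ as
decodeList-encodeList as = go as (encodeList as) ≤-refl
  where
  go : ∀ as f → encodeList as ≤ f → decodeList′ f (encodeList as) ≡ as
  go []       zero    _ = refl
  go []       (suc f) _ = refl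
  go (a ∷ as) (suc f) (s≤s p) =
    trans (decodeList-cons f (pair a (encodeList as)) a (encodeList as) (unpair-pair a (encodeList as)))
      (cong (a ∷_) (go as f (≤-trans (snd≤pair a (encodeList as)) p)))

encodeMove : Move → ℕ
encodeMove L = 0
encodeMove R = 1
encodeMove S = 2

decodeMove-encodeMove : ∀ m → decodeMove (encodeMove m) ≡ m
decodeMove-encodeMove L = refl
decodeMove-encodeMove R = refl
decodeMove-encodeMove S = refl

encodeQ : Maybe Bool → ℕ
encodeQ nothing      = 0
encodeQ (just false) = 1
encodeQ (just true)  = 2

decodeQ-encodeQ : ∀ q → decodeQ (encodeQ q) ≡ q
decodeQ-encodeQ nothing      = refl
decodeQ-encodeQ (just false) = refl
decodeQ-encodeQ (just true)  = refl

encodeRule : Rule → ℕ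
encodeRule (rule s a s' w m q) =
  pair s (pair a (pair s' (pair w (pair (encodeMove m) (encodeQ q)))))

decodeRule-encodeRule : ∀ ρ → decodeRule (encodeRule ρ) ≡ ρ
decodeRule-encodeRule (rule s a s' w m q)
  rewrite unpair-pair s (pair a (pair s' (pair w (pair (encodeMove m) (encodeQ q)))))
        | unpair-pair a (pair s' (pair w (pair (encodeMove m) (encodeQ q))))
        | unpair-pair s' (pair w (pair (encodeMove m) (encodeQ q)))
        | unpair-pair w (pair (encodeMove m) (encodeQ q))
        | unpair-pair (encodeMove m) (encodeQ q)
        | decodeMove-encodeMove m | decodeQ-encodeQ q = refl

index : Machine → ℕ
index M = suc (suc (encodeList (map encodeRule M)))

N-index : ∀ M → N (index M) ≡ M
N-index M rewrite decodeList-encodeList (map encodeRule M) = go M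
  where
  go : ∀ M → map decodeRule (map encodeRule M) ≡ M
  go []      = refl
  go (ρ ∷ M) = cong₂ _∷_ (decodeRule-encodeRule ρ) (go M)

consHead : Bool → List Word → List Word
consHead b []       = (b ∷ []) ∷ []
consHead b (u ∷ us) = (b ∷ u) ∷ us

untuple : Word → List Word
untuple (false ∷ true ∷ w) = [] ∷ untuple w
untuple (b ∷ _ ∷ w)        = consHead b (untuple w)
untuple _                  = []

untuple-head : ∀ u w → untuple ((dbl u ++ false ∷ true ∷ []) ++ w) ≡ u ∷ untuple w
untuple-head []          w = refl
untuple-head (false ∷ u) w = cong (consHead false) (untuple-head u w)
untuple-head (true ∷ u)  w = cong (consHead true) (untuple-head u w)

untuple-⟨⟩ : ∀ us → untuple ⟨ us ⟩ ≡ us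
untuple-⟨⟩ []       = refl
untuple-⟨⟩ (u ∷ us) = trans (untuple-head u ⟨ us ⟩) (cong (u ∷_) (untuple-⟨⟩ us))

dbl-length : ∀ u → ∣ dbl u ∣ ≡ 2 * ∣ u ∣
dbl-length []      = refl
dbl-length (b ∷ u) = trans (cong (λ k → suc (suc k)) (dbl-length u)) (cong suc (≡.sym (+-suc _ _)))

⟨⟩-length : ∀ u us → ∣ ⟨ u ∷ us ⟩ ∣ ≡ 2 * ∣ u ∣ + 2 + ∣ ⟨ us ⟩ ∣
⟨⟩-length u us = trans (length-++ (dbl u ++ false ∷ true ∷ []))
  (cong (_+ ∣ ⟨ us ⟩ ∣) (trans (length-++ (dbl u)) (cong (_+ 2) (dbl-length u))))

∈-⟨⟩-length : ∀ {u us} → u ∈ us → ∣ u ∣ < ∣ ⟨ us ⟩ ∣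
∈-⟨⟩-length {us = v ∷ us} i = ≤-trans (bound i) (≤-reflexive (≡.sym (⟨⟩-length v us)))
  where
  bound : ∀ {u} → u ∈ v ∷ us → ∣ u ∣ < 2 * ∣ v ∣ + 2 + ∣ ⟨ us ⟩ ∣
  bound (here refl) = ≤-trans (≤-reflexive (+-comm 1 ∣ v ∣))
    (≤-trans (+-mono-≤ (m≤m+n ∣ v ∣ _) (s≤s (z≤n {1}))) (m≤m+n _ ∣ ⟨ us ⟩ ∣))
  bound (there i)   = ≤-trans (∈-⟨⟩-length i) (m≤n+m _ (2 * ∣ v ∣ + 2))

0^-length : ∀ n → ∣ 0^ n ∣ ≡ n
0^-length n = length-replicate n

-- Deciding C and D, and the part of the oracle that matters

_≟ʷ_ : (u v : Word) → Dec (u ≡ v)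
_≟ʷ_ = ≡-dec _≟ᵇ_

InLpᵇ : Oracle → ℕ → ℕ → Word → Bool
InLpᵇ O i p x = accWithin O (N i) (p ⊓ pᵢ i ∣ x ∣) (initConfig x)

inC₃ : Oracle → Word → List Word → Bool
inC₃ O y (a ∷ x ∷ b ∷ []) =
  ⌊ y ≟ʷ ⟨ 0^ ∣ a ∣ ∷ x ∷ 0^ ∣ b ∣ ∷ [] ⟩ ⌋ ∧ InLpᵇ O ∣ a ∣ ∣ b ∣ x
inC₃ O y _ = false

inC : Oracle → Word → Bool
inC O y = inC₃ O y (untuple y)

inD₄ : Oracle → Word → List Word → Bool
inD₄ O y (a ∷ b ∷ x ∷ c ∷ []) =
  ⌊ y ≟ʷ ⟨ 0^ ∣ a ∣ ∷ 0^ ∣ b ∣ ∷ x ∷ 0^ ∣ c ∣ ∷ [] ⟩ ⌋ ∧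
  (InLpᵇ O ∣ a ∣ ∣ c ∣ x ∧ not (InLpᵇ O ∣ b ∣ ∣ c ∣ x))
inD₄ O y _ = false

inD : Oracle → Word → Bool
inD O y = inD₄ O y (untuple y)

∧-true : ∀ {a b} → a ∧ b ≡ true → a ≡ true × b ≡ true
∧-true {true} {true} e = refl , refl

not-true : ∀ {a} → not a ≡ true → a ≡ false
not-true {false} e = refl

true≢false : ∀ {a} → a ≡ true → a ≡ false → ⊥
true≢false refl ()

≟ʷ-refl : ∀ u → ⌊ u ≟ʷ u ⌋ ≡ true
≟ʷ-refl u with u ≟ʷ u
... | yes _ = refl
... | no ¬p = ⊥-elim (¬p refl)

⌊⌋-true : ∀ {P : Set} {d : Dec P} → ⌊ d ⌋ ≡ true → P
⌊⌋-true {d = yes p} e = p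

inC-complete : ∀ O y → C O y → inC O y ≡ true
inC-complete O y (i , x , p , refl , acc)
  rewrite untuple-⟨⟩ (0^ i ∷ x ∷ 0^ p ∷ []) | 0^-length i | 0^-length p
        | ≟ʷ-refl ⟨ 0^ i ∷ x ∷ 0^ p ∷ [] ⟩ = acc

inC-sound : ∀ O y → inC O y ≡ true → C O y
inC-sound O y e with untuple y
... | a ∷ x ∷ b ∷ [] with ∧-true {⌊ y ≟ʷ ⟨ 0^ ∣ a ∣ ∷ x ∷ 0^ ∣ b ∣ ∷ [] ⟩ ⌋} e
... | e₁ , e₂ = ∣ a ∣ , x , ∣ b ∣ , ⌊⌋-true e₁ , e₂

inD-complete : ∀ O y → D O y → inD O y ≡ true
inD-complete O y (i , j , x , p , refl , acc , rej)
  rewrite untuple-⟨⟩ (0^ i ∷ 0^ j ∷ x ∷ 0^ p ∷ []) | 0^-length i | 0^-length j | 0^-length p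
        | ≟ʷ-refl ⟨ 0^ i ∷ 0^ j ∷ x ∷ 0^ p ∷ [] ⟩ | acc
  with InLpᵇ O j p x
... | true  = ⊥-elim (rej refl)
... | false = refl

inD-sound : ∀ O y → inD O y ≡ true → D O y
inD-sound O y e with untuple y
... | a ∷ b ∷ x ∷ c ∷ [] with ∧-true {⌊ y ≟ʷ ⟨ 0^ ∣ a ∣ ∷ 0^ ∣ b ∣ ∷ x ∷ 0^ ∣ c ∣ ∷ [] ⟩ ⌋} e
... | e₁ , e₂ with ∧-true {InLpᵇ O ∣ a ∣ ∣ c ∣ x} e₂
... | e₃ , e₄ = ∣ a ∣ , ∣ b ∣ , x , ∣ c ∣ , ⌊⌋-true e₁ , e₃ , λ acc → true≢false acc (not-true e₄)

bool-≡ : ∀ {a b : Bool} → (a ≡ true → b ≡ true) → (b ≡ true → a ≡ true) → a ≡ b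
bool-≡ {true}          f g = ≡.sym (f refl)
bool-≡ {false} {true}  f g = g refl
bool-≡ {false} {false} f g = refl

InLp-uses : ∀ O i p x → InLpᵇ O i p x ≡ true → Uses (suc p) p O (λ O' → InLpᵇ O' i p x ≡ true)
InLp-uses O i p x e = uses-weaken (s≤s bound) bound (accWithin-uses O (N i) _ (initConfig x) e)
  where
  bound : ∣ query (initConfig x) ∣ + (p ⊓ pᵢ i ∣ x ∣) ≤ p
  bound rewrite initConfig-query x = m⊓n≤m p _

Below : ℕ → Oracle → Oracle → Set
Below ℓ O O' = ∀ v → ∣ v ∣ < ℓ → O v ≡ O' v

below-sym : ∀ {ℓ O O'} → Below ℓ O O' → Below ℓ O' O
below-sym b v v< = ≡.sym (b v v<)

below-weaken : ∀ {ℓ ℓ' O O'} → ℓ' ≤ ℓ → Below ℓ O O' → Below ℓ' O O'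
below-weaken p b v v< = b v (≤-trans v< p)

InLp-local : ∀ {O O'} i p x → Below (suc p) O O' → InLpᵇ O i p x ≡ InLpᵇ O' i p x
InLp-local {O} {O'} i p x b = bool-≡
  (λ e → uses-local (InLp-uses O i p x e) O' (below-sym b))
  (λ e → uses-local (InLp-uses O' i p x e) O b)

-- The time bound `p` occurs in `y` in unary, so an accepting branch asks only queries shorter than
-- `y`. This makes it possible to test membership in C inside the definition of the oracle.
inC-uses : ∀ O y → inC O y ≡ true → Uses ∣ y ∣ ∣ y ∣ O (λ O' → inC O' y ≡ true)
inC-uses O y e with inC-sound O y e
... | i , x , p , refl , acc =
  uses-weaken p< (≤-trans (n≤1+n p) p<)
    (uses-map (λ O' e' → inC-complete O' y (i , x , p , refl , e')) (InLp-uses O i p x acc))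
  where
  p< : p < ∣ y ∣
  p< = subst (_< ∣ y ∣) (0^-length p) (∈-⟨⟩-length {us = 0^ i ∷ x ∷ 0^ p ∷ []} (there (there (here refl))))

inC-local : ∀ {O O'} y → Below ∣ y ∣ O O' → inC O y ≡ inC O' y
inC-local {O} {O'} y b = bool-≡
  (λ e → uses-local (inC-uses O y e) O' (below-sym b))
  (λ e → uses-local (inC-uses O' y e) O b)

inD-local : ∀ {O O'} y → Below ∣ y ∣ O O' → inD O y ≡ inD O' y
inD-local {O} {O'} y b = bool-≡ (go O O' b) (go O' O (below-sym b))
  where
  go : ∀ O O' → Below ∣ y ∣ O O' → inD O y ≡ true → inD O' y ≡ true
  go O O' b e with inD-sound O y e
  ... | i , j , x , p , refl , acc , rej =
    inD-complete O' y (i , j , x , p , refl ,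
      trans (≡.sym (InLp-local i p x b')) acc , λ acc' → rej (trans (InLp-local j p x b') acc'))
    where
    p< : p < ∣ y ∣
    p< = subst (_< ∣ y ∣) (0^-length p)
      (∈-⟨⟩-length {us = 0^ i ∷ 0^ j ∷ x ∷ 0^ p ∷ []} (there (there (there (here refl)))))
    b' : Below (suc p) O O'
    b' = below-weaken p< b

-- The oracle generated by a set of witnesses

tower : ℕ → ℕ
tower zero    = 1
tower (suc s) = 2 ^ tower s

-- The summand 5 provides a factor 32, by which the number of witnesses exceeds
-- `2 * stageLen (suc s)`; see `horizon-small`.
witnessLen : ℕ → ℕ
witnessLen s = tower s + 5

stageLen : ℕ → ℕ
stageLen s = 3 + witnessLen s

-- The number of the diagonal in the Cantor enumeration on which `s` lies. Block `d` thus consists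
-- of `d + 1` consecutive stages.
block : ℕ → ℕ
block s = proj₁ (unpair s) + proj₂ (unpair s)

-- Constant on a block. Transducer `k` is the target of every block `pair k m`, hence of whole
-- blocks that lie arbitrarily late.
target : ℕ → ℕ
target s = proj₁ (unpair (block s))

-- Guesses z of the length of its input and accepts if b00z is in the oracle.
guesser : Bool → Machine
guesser b =
  rule 0 1 6 1 S (just b) ∷
  rule 6 1 7 1 S (just false) ∷
  rule 7 1 8 1 S (just false) ∷
  rule 8 1 8 1 R (just false) ∷
  rule 8 1 8 1 R (just true) ∷
  rule 8 0 3 0 S nothing ∷
  rule 4 0 1 0 S nothing ∷ []

length≤encodeList : ∀ as → length as ≤ encodeList as
length≤encodeList []       = z≤n
length≤encodeList (a ∷ as) = s≤s (≤-trans (length≤encodeList as) (snd≤pair a (encodeList as)))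

length≤index : ∀ M → 2 + length M ≤ index M
length≤index M = s≤s (s≤s (≤-trans (≤-reflexive (≡.sym (length-map encodeRule M))) (length≤encodeList (map encodeRule M))))

-- Unary codes of machines are astronomically large and must not be evaluated.
abstract
  indexed : ∀ M → ∃[ i ] N i ≡ M × 2 + length M ≤ i
  indexed M = index M , N-index M , length≤index M

guesserIndex : Bool → ℕ
guesserIndex b = proj₁ (indexed (guesser b))

N-guesserIndex : ∀ b → N (guesserIndex b) ≡ guesser b
N-guesserIndex b = proj₁ (proj₂ (indexed (guesser b)))

guesserIndex-large : ∀ b → 6 ≤ guesserIndex b
guesserIndex-large b = ≤-trans (m≤n+m 6 3) (proj₂ (proj₂ (indexed (guesser b))))

-- Besides one step per guessed bit, a guesser takes three steps to write the prefix `b00` and three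
-- to enter the query state, get the answer and accept. This is the 6 in the time bound.
hard : ℕ → Word
hard s = ⟨ 0^ (guesserIndex false) ∷ 0^ (guesserIndex true) ∷ 0^ (witnessLen s) ∷ 0^ (witnessLen s + 6) ∷ [] ⟩

unary : ℕ → Word → Word
unary zero    w = false ∷ w
unary (suc a) w = true ∷ unary a w

dec₁ : Word → ℕ × Word
dec₁ []          = 0 , []
dec₁ (false ∷ w) = 0 , w
dec₁ (true ∷ w)  = suc (proj₁ (dec₁ w)) , proj₂ (dec₁ w)

dec₁-unary : ∀ a w → dec₁ (unary a w) ≡ (a , w)
dec₁-unary zero    w = refl
dec₁-unary (suc a) w rewrite dec₁-unary a w = refl

dec₁-length : ∀ w → proj₁ (dec₁ w) + ∣ proj₂ (dec₁ w) ∣ ≤ ∣ w ∣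
dec₁-length []          = z≤n
dec₁-length (false ∷ w) = n≤1+n _
dec₁-length (true ∷ w)  = s≤s (dec₁-length w)

unary-length : ∀ a w → ∣ unary a w ∣ ≡ a + suc ∣ w ∣
unary-length zero    w = refl
unary-length (suc a) w = cong suc (unary-length a w)

parse : Word → ℕ × ℕ × Word
parse w = proj₁ (dec₁ w) , dec₁ (proj₂ (dec₁ w))

parse-unary : ∀ a t x → parse (unary a (unary t x)) ≡ (a , t , x)
parse-unary a t x rewrite dec₁-unary a (unary t x) | dec₁-unary t x = refl

parse-length : ∀ {w a t x} → parse w ≡ (a , t , x) → a + (t + ∣ x ∣) ≤ ∣ w ∣
parse-length {w} refl = ≤-trans (+-monoʳ-≤ (proj₁ (dec₁ w)) (dec₁-length (proj₂ (dec₁ w)))) (dec₁-length w)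

≤ᵇ-true : ∀ {m n} → (m ≤ᵇ n) ≡ true → m ≤ n
≤ᵇ-true {m} {n} e = ≤ᵇ⇒≤ m n (subst T (≡.sym e) _)

true-≤ᵇ : ∀ {m n} → m ≤ n → (m ≤ᵇ n) ≡ true
true-≤ᵇ {m} {n} p with m ≤ᵇ n | ≤⇒≤ᵇ p
... | true | _ = refl

<ᵇ-true : ∀ {m n} → (m <ᵇ n) ≡ true → m < n
<ᵇ-true {m} {n} e = <ᵇ⇒< m n (subst T (≡.sym e) _)

true-<ᵇ : ∀ {m n} → m < n → (m <ᵇ n) ≡ true
true-<ᵇ {m} {n} p with m <ᵇ n | <⇒<ᵇ p
... | true | _ = refl

anyBelow : (ℕ → Bool) → ℕ → Bool
anyBelow p zero    = false
anyBelow p (suc n) = p n ∨ anyBelow p n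

anyBelow-complete : ∀ p n {k} → k < n → p k ≡ true → anyBelow p n ≡ true
anyBelow-complete p (suc n) {k} k< e with k ≟ n
... | yes refl rewrite e = refl
... | no k≢n with p n
... | true  = refl
... | false = anyBelow-complete p n (≤∧≢⇒< (≤-pred k<) k≢n) e

anyBelow-sound : ∀ p n → anyBelow p n ≡ true → ∃[ k ] k < n × p k ≡ true
anyBelow-sound p (suc n) e with p n in pn
... | true  = n , ≤-refl , pn
... | false with anyBelow-sound p n e
... | k , k< , pk = k , ≤-trans k< (n≤1+n n) , pk

wordsUpTo : ℕ → List Word
wordsUpTo zero    = [] ∷ []
wordsUpTo (suc n) = [] ∷ map (true ∷_) (wordsUpTo n) ++ map (false ∷_) (wordsUpTo n)

wordsUpTo-complete : ∀ n {w} → ∣ w ∣ ≤ n → w ∈ wordsUpTo n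
wordsUpTo-complete zero    {[]}        p       = here refl
wordsUpTo-complete (suc n) {[]}        p       = here refl
wordsUpTo-complete (suc n) {true ∷ w}  (s≤s p) = there (∈-++⁺ˡ (∈-map⁺ (true ∷_) (wordsUpTo-complete n p)))
wordsUpTo-complete (suc n) {false ∷ w} (s≤s p) =
  there (∈-++⁺ʳ (map (true ∷_) (wordsUpTo n)) (∈-map⁺ (false ∷_) (wordsUpTo-complete n p)))

wordsUpTo-sound : ∀ n {w} → w ∈ wordsUpTo n → ∣ w ∣ ≤ n
wordsUpTo-sound zero    (here refl) = z≤n
wordsUpTo-sound (suc n) (here refl) = z≤n
wordsUpTo-sound (suc n) (there i) with ∈-++⁻ (map (true ∷_) (wordsUpTo n)) i
... | inj₁ i₁ with ∈-map⁻ (true ∷_) i₁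
... | u , i₂ , refl = s≤s (wordsUpTo-sound n i₂)
wordsUpTo-sound (suc n) (there i) | inj₂ i₁ with ∈-map⁻ (false ∷_) i₁
... | u , i₂ , refl = s≤s (wordsUpTo-sound n i₂)

-- Transducers and how they are caught

abstract
  transduce : Oracle → ℕ → ℕ → Word → Maybe Word
  transduce O j t x = Maybe.map output (runD O (N j) t (initConfig x))

  transduce-uses : ∀ O j t x → Uses (suc t) t O (λ O' → transduce O' j t x ≡ transduce O j t x)
  transduce-uses O j t x = uses-weaken (s≤s bound) bound
    (uses-map (λ O' → cong (Maybe.map output)) (runD-uses O (N j) t (initConfig x)))
    where
    bound : ∣ query (initConfig x) ∣ + t ≤ t
    bound rewrite initConfig-query x = ≤-refl

  transduce-length : ∀ O j t x {y} → transduce O j t x ≡ just y → ∣ y ∣ ≤ suc (t + ∣ x ∣)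
  transduce-length O j t x e with runD O (N j) t (initConfig x) in r
  transduce-length O j t x refl | just c =
    ≤-trans (output-tape c) (s≤s (≤-trans (runD-tape O (N j) t (initConfig x) r)
      (≤-trans (+-monoˡ-≤ t (initConfig-tape x)) (≤-reflexive (+-comm ∣ x ∣ t)))))

  transduce-just : ∀ O j t x {c} → runD O (N j) t (initConfig x) ≡ just c → transduce O j t x ≡ just (output c)
  transduce-just O j t x e = cong (Maybe.map output) e

  just-transduce : ∀ O j t x {y} → transduce O j t x ≡ just y →
    ∃[ c ] runD O (N j) t (initConfig x) ≡ just c × output c ≡ y
  just-transduce O j t x e with runD O (N j) t (initConfig x)
  just-transduce O j t x refl | just c = c , refl , refl

transduce-local : ∀ {O O'} j t x → Below (suc t) O O' → transduce O j t x ≡ transduce O' j t x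
transduce-local {O} {O'} j t x b = ≡.sym (uses-local (transduce-uses O j t x) O' (below-sym b))

errs : Oracle → Maybe Word → Bool
errs O nothing  = false
errs O (just y) = inC O y

violates₃ : Oracle → ℕ → ℕ × ℕ × Word → Bool
violates₃ O j (a , t , x) = (a ≡ᵇ suc j) ∧ errs O (transduce O j t x)

violates : Oracle → ℕ → Word → Bool
violates O j w = violates₃ O j (parse w)

≡ᵇ-true : ∀ a b → (a ≡ᵇ b) ≡ true → a ≡ b
≡ᵇ-true a b e = ≡ᵇ⇒≡ a b (subst T (≡.sym e) _)

-- One share of `2 * ∣ w ∣` pays for the run of the transducer, the other for a branch that puts its
-- value into C. Both ask only queries shorter than `w`: the unary tag `suc j` gives the extra 1
-- that makes the time strictly smaller than `∣ w ∣` and the value no longer than `w`.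
violates-uses : ∀ O j w → violates O j w ≡ true → Uses ∣ w ∣ (2 * ∣ w ∣) O (λ O' → violates O' j w ≡ true)
violates-uses O j w e = go (parse w) (parse-length {w} refl) e
  where
  go : ∀ p → proj₁ p + (proj₁ (proj₂ p) + ∣ proj₂ (proj₂ p) ∣) ≤ ∣ w ∣ → violates₃ O j p ≡ true →
    Uses ∣ w ∣ (2 * ∣ w ∣) O (λ O' → violates₃ O' j p ≡ true)
  go (a , t , x) len e with ∧-true {a ≡ᵇ suc j} e
  ... | e₁ , e₂ with transduce O j t x in r
  ... | just y = uses-weaken ≤-refl
    (≤-trans (+-mono-≤ (≤-trans (n≤1+n t) t<) y≤) (≤-reflexive (cong (∣ w ∣ +_) (≡.sym (+-identityʳ _)))))
    (uses-map (λ O' (r' , acc) → both O' (trans r' r) acc)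
      (uses-× (uses-weaken t< ≤-refl (transduce-uses O j t x)) (uses-weaken y≤ ≤-refl (inC-uses O y e₂))))
    where
    len' : suc (t + ∣ x ∣) ≤ ∣ w ∣
    len' = ≤-trans (s≤s (m≤n+m _ j)) (subst (λ k → k + (t + ∣ x ∣) ≤ ∣ w ∣) (≡ᵇ-true a (suc j) e₁) len)
    t< : t < ∣ w ∣
    t< = ≤-trans (s≤s (m≤m+n t _)) len'
    y≤ : ∣ y ∣ ≤ ∣ w ∣
    y≤ = ≤-trans (transduce-length O j t x r) len'
    both : ∀ O' → transduce O' j t x ≡ just y → inC O' y ≡ true → violates₃ O' j (a , t , x) ≡ true
    both O' q acc rewrite e₁ | q = acc

violates-local : ∀ {O O'} j w → Below ∣ w ∣ O O' → violates O j w ≡ violates O' j w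
violates-local {O} {O'} j w b = bool-≡
  (λ e → uses-local (violates-uses O j w e) O' (below-sym b))
  (λ e → uses-local (violates-uses O' j w e) O b)

abstract
  dead : Oracle → ℕ → ℕ → Bool
  dead O j ℓ = any (violates O j) (wordsUpTo ℓ)

  dead-intro : ∀ O j {ℓ} w → ∣ w ∣ ≤ ℓ → violates O j w ≡ true → dead O j ℓ ≡ true
  dead-intro O j {ℓ} w w≤ e = any-∈ (violates O j) {w} (wordsUpTo ℓ) (wordsUpTo-complete ℓ w≤) e

  dead-elim : ∀ O j ℓ → dead O j ℓ ≡ true → ∃[ w ] ∣ w ∣ ≤ ℓ × violates O j w ≡ true
  dead-elim O j ℓ e with ∈-any (violates O j) (wordsUpTo ℓ) e
  ... | w , i , v = w , wordsUpTo-sound ℓ i , v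

dead-mono : ∀ O j {ℓ ℓ'} → ℓ ≤ ℓ' → dead O j ℓ ≡ true → dead O j ℓ' ≡ true
dead-mono O j {ℓ} p e with dead-elim O j ℓ e
... | w , w≤ , v = dead-intro O j w (≤-trans w≤ p) v

dead-local : ∀ {O O'} j ℓ → Below ℓ O O' → dead O j ℓ ≡ dead O' j ℓ
dead-local {O} {O'} j ℓ b = bool-≡ (go O O' b) (go O' O (below-sym b))
  where
  go : ∀ O O' → Below ℓ O O' → dead O j ℓ ≡ true → dead O' j ℓ ≡ true
  go O O' b e with dead-elim O j ℓ e
  ... | w , w≤ , v = dead-intro O' j w w≤ (trans (≡.sym (violates-local j w (below-weaken w≤ b))) v)

abstract
  -- Trust in `j` is delayed until a stage whose block exceeds `j`. Before the lengths of stage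
  -- `suc s`, `hf` therefore consults the trust only of the finitely many `j < block s`, and only
  -- those have to be stable at stage `s`.
  admitted : ℕ → ℕ → Bool
  admitted j ℓ = anyBelow (λ s → (stageLen s ≤ᵇ ℓ) ∧ (j <ᵇ block s)) (suc ℓ)

  admitted-intro : ∀ s j ℓ → s ≤ ℓ → stageLen s ≤ ℓ → j < block s → admitted j ℓ ≡ true
  admitted-intro s j ℓ s≤ p q = anyBelow-complete (λ s → (stageLen s ≤ᵇ ℓ) ∧ (j <ᵇ block s)) (suc ℓ) (s≤s s≤)
    (cong₂ _∧_ (true-≤ᵇ p) (true-<ᵇ q))

  admitted-elim : ∀ j ℓ → admitted j ℓ ≡ true → ∃[ s ] stageLen s ≤ ℓ × j < block s
  admitted-elim j ℓ e with anyBelow-sound (λ s → (stageLen s ≤ᵇ ℓ) ∧ (j <ᵇ block s)) (suc ℓ) e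
  ... | s , _ , e' with ∧-true {stageLen s ≤ᵇ ℓ} e'
  ... | e₁ , e₂ = s , ≤ᵇ-true e₁ , <ᵇ-true e₂

padded : (Oracle → Word → Bool) → Oracle → ℕ → Word → Word
padded A O t x = if (stageLen ∣ x ∣ ≤ᵇ t) ∧ not (A O x) then x else []

-- The code 1ʲ⁺¹01ᵗ0x names the value of transducer j at x, computed in t steps;
-- it is honoured until j has produced an element of C on some code that is not
-- longer. A code 01ᵗ0x names x itself, with so much padding that the test
-- whether x lies in C concerns only earlier stages.
hf₃ : Oracle → ℕ → ℕ × ℕ × Word → Word
hf₃ O ℓ (zero  , t , x) = padded inC O t x
hf₃ O ℓ (suc j , t , x) = if admitted j ℓ ∧ not (dead O j ℓ) then fromMaybe [] (transduce O j t x) else []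

hf : Oracle → Word → Word
hf O w = hf₃ O ∣ w ∣ (parse w)

-- `hard s` is given out without a test of membership in D; the soundness of this clause comes from
-- the construction (`hard-verdict`). The condition on `t` makes the code long enough for the value
-- to have polynomial length.
hg₃ : Oracle → ℕ → ℕ × ℕ × Word → Word
hg₃ O k (zero  , t , x) = padded inD O t x
hg₃ O k (suc s , t , x) = if (target s ≡ᵇ k) ∧ (witnessLen s ≤ᵇ t) then hard s else []

hg : Oracle → ℕ → Word → Word
hg O k w = hg₃ O k (parse w)

pad : List ℕ → Word → Word
pad []      x = []
pad (j ∷ q) x = unary (suc j) (unary (eval q ∣ x ∣) x)

-- The padding functions are stored in the oracle only to spare a machine that
-- computes them.
stored₂ : Oracle → ℕ × ℕ → Word → Word
stored₂ O (zero  , k) w = hg O k w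
stored₂ O (suc _ , e) w = pad (decodeList e) w

stored : Oracle → ℕ → Word → Word
stored O zero    w = hf O w
stored O (suc e) w = stored₂ O (unpair e) w

bit : ℕ → Word → Bool
bit i       []      = false
bit zero    (b ∷ y) = b
bit (suc i) (b ∷ y) = bit i y

readBit : Bool → ℕ → Word → Bool
readBit true  i y = i <ᵇ ∣ y ∣
readBit false i y = bit i y

-- A query has the form b1ⁱ01ᶜ0z. It is a free witness if c = 0; otherwise it
-- asks for the i-th bit (b = 0), or for the existence of an i-th bit (b = 1),
-- of the value of the stored function c - 1 at the reverse of z.
answer₃ : (Word → Bool) → Oracle → Word → Bool → ℕ × ℕ × Word → Bool
answer₃ W O v b (i , zero  , z) = W v
answer₃ W O v b (i , suc e , z) = readBit b i (stored O e (reverse z))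

answer : (Word → Bool) → Oracle → Word → Bool
answer W O []      = W []
answer W O (b ∷ r) = answer₃ W O (b ∷ r) b (parse r)

hf-local : ∀ {O O'} w → Below ∣ w ∣ O O' → hf O w ≡ hf O' w
hf-local {O} {O'} w b = go (parse w) (parse-length {w} refl)
  where
  go : ∀ p → proj₁ p + (proj₁ (proj₂ p) + ∣ proj₂ (proj₂ p) ∣) ≤ ∣ w ∣ → (hf₃ O ∣ w ∣ p) ≡ (hf₃ O' ∣ w ∣ p)
  go (zero , t , x) len =
    cong (λ A → if (stageLen ∣ x ∣ ≤ᵇ t) ∧ not A then x else [])
      (inC-local x (below-weaken (≤-trans (m≤n+m _ t) len) b))
  go (suc j , t , x) len =
    cong₂ (λ A y → if (admitted j ∣ w ∣) ∧ not A then fromMaybe [] y else []) (dead-local j ∣ w ∣ b)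
      (transduce-local j t x (below-weaken (≤-trans (s≤s (≤-trans (m≤m+n t _) (m≤n+m _ j))) len) b))

hg-local : ∀ {O O'} k w → Below ∣ w ∣ O O' → hg O k w ≡ hg O' k w
hg-local {O} {O'} k w b = go (parse w) (parse-length {w} refl)
  where
  go : ∀ p → proj₁ p + (proj₁ (proj₂ p) + ∣ proj₂ (proj₂ p) ∣) ≤ ∣ w ∣ → hg₃ O k p ≡ hg₃ O' k p
  go (zero , t , x) len =
    cong (λ A → if (stageLen ∣ x ∣ ≤ᵇ t) ∧ not A then x else [])
      (inD-local x (below-weaken (≤-trans (m≤n+m _ t) len) b))
  go (suc s , t , x) len = refl

stored-local : ∀ {O O'} e w → Below ∣ w ∣ O O' → stored O e w ≡ stored O' e w
stored-local zero    w b = hf-local w b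
stored-local (suc e) w b with unpair e
... | zero  , k = hg-local k w b
... | suc _ , k = refl

argument-length : ∀ {r i c z} → parse r ≡ (i , c , z) → ∣ reverse z ∣ ≤ ∣ r ∣
argument-length {r} {i} {c} {z} e = ≤-trans (≤-reflexive (length-reverse z))
  (≤-trans (m≤n+m _ c) (≤-trans (m≤n+m _ i) (parse-length {r} e)))

answer-local : ∀ {W W' O O'} v → W v ≡ W' v → Below ∣ v ∣ O O' → answer W O v ≡ answer W' O' v
answer-local []      w b = w
answer-local {W} {W'} {O} {O'} (c ∷ r) w b = go (parse r) refl
  where
  go : ∀ p → parse r ≡ p → answer₃ W O (c ∷ r) c p ≡ answer₃ W' O' (c ∷ r) c p
  go (i , zero  , z) e = w
  go (i , suc k , z) e = cong (readBit c i)
    (stored-local k (reverse z) (below-weaken (≤-trans (argument-length {r} e) (n≤1+n _)) b))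

-- The recursion on the length of a query, unfolded with fuel: an answer depends on shorter words
-- only, so any fuel beyond the length gives the same value.
approx : (Word → Bool) → ℕ → Oracle
approx W zero    v = false
approx W (suc n) v = answer W (approx W n) v

approx-stable : ∀ W m n v → ∣ v ∣ < m → ∣ v ∣ < n → approx W m v ≡ approx W n v
approx-stable W (suc m) (suc n) v (s≤s p) (s≤s q) = answer-local v refl λ u u< →
  approx-stable W m n u (≤-trans u< p) (≤-trans u< q)

abstract
  Ext : (Word → Bool) → Oracle
  Ext W v = approx W (suc ∣ v ∣) v

  Ext-answer : ∀ W v → Ext W v ≡ answer W (Ext W) v
  Ext-answer W v = answer-local v refl λ u u< → approx-stable W ∣ v ∣ (suc ∣ u ∣) u u< ≤-refl

Ext-below : ∀ W W' ℓ → (∀ v → ∣ v ∣ < ℓ → W v ≡ W' v) → Below ℓ (Ext W) (Ext W')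
Ext-below W W' zero    w v ()
Ext-below W W' (suc ℓ) w v v< = trans (Ext-answer W v) (trans
  (answer-local v (w v v<) (below-weaken (≤-pred v<) (Ext-below W W' ℓ λ u u< → w u (≤-trans u< (n≤1+n ℓ)))))
  (≡.sym (Ext-answer W' v)))

-- Stages

n<2^n : ∀ n → n < 2 ^ n
n<2^n zero    = s≤s z≤n
n<2^n (suc n) = ≤-trans (+-mono-≤ (m^n>0 2 n) (n<2^n n)) (+-monoʳ-≤ (2 ^ n) (m≤m+n _ 0))

tower-mono : ∀ {s s'} → s ≤ s' → tower s ≤ tower s'
tower-mono s≤s' = go (≤⇒≤′ s≤s')
  where
  go : ∀ {s s'} → s ≤′ s' → tower s ≤ tower s'
  go ≤′-refl           = ≤-refl
  go (≤′-step {s'} p) = ≤-trans (go p) (<⇒≤ (n<2^n (tower s')))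

s<tower : ∀ s → s < tower s
s<tower zero    = s≤s z≤n
s<tower (suc s) = ≤-trans (s≤s (s<tower s)) (n<2^n (tower s))

stageLen-mono : ∀ {s s'} → s ≤ s' → stageLen s ≤ stageLen s'
stageLen-mono p = +-monoʳ-≤ 3 (+-monoˡ-≤ 5 (tower-mono p))

s<stageLen : ∀ s → s < stageLen s
s<stageLen s = ≤-trans (s<tower s) (≤-trans (m≤m+n _ 5) (m≤n+m _ 3))

stageLen-reflects : ∀ s s' → stageLen s < stageLen (suc s') → s ≤ s'
stageLen-reflects s s' p with s ≤? s'
... | yes q = q
... | no ¬q = ⊥-elim (<⇒≱ p (stageLen-mono (≰⇒> ¬q)))

block-mono : ∀ {s s'} → s ≤ s' → block s ≤ block s'
block-mono s≤s' = go (≤⇒≤′ s≤s')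
  where
  step : ∀ s → block s ≤ block (suc s)
  step s with unpair s
  ... | zero  , b = ≤-trans (n≤1+n b) (≤-reflexive (≡.sym (+-identityʳ _)))
  ... | suc a , b = ≤-reflexive (≡.sym (+-suc a b))
  go : ∀ {s s'} → s ≤′ s' → block s ≤ block s'
  go ≤′-refl          = ≤-refl
  go (≤′-step {s'} p) = ≤-trans (go p) (step s')

-- This is `stageLen (suc s) - 1`, the longest time in which a run cannot write a query as long as
-- the witnesses of the next stage.
horizon : ℕ → ℕ
horizon s = 2 + witnessLen (suc s)

abstract
  horizon-small : ∀ s → 2 * stageLen (suc s) < 2 ^ witnessLen s
  horizon-small s = subst (2 * (3 + (T' + 5)) <_) (≡.sym (^-distribˡ-+-* 2 (tower s) 5)) (begin-strict
    2 * (3 + (T' + 5)) ≡⟨ cong (2 *_) (+-comm 3 (T' + 5)) ⟩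
    2 * (T' + 5 + 3)   ≡⟨ cong (2 *_) (+-assoc T' 5 3) ⟩
    2 * (T' + 8)       ≡⟨ *-distribˡ-+ 2 T' 8 ⟩
    2 * T' + 16        <⟨ +-monoʳ-< (2 * T') (m≤m+n 17 13) ⟩
    2 * T' + 30 * 1    ≤⟨ +-monoʳ-≤ (2 * T') (*-monoʳ-≤ 30 (m^n>0 2 (tower s))) ⟩
    2 * T' + 30 * T'   ≡⟨ ≡.sym (*-distribʳ-+ T' 2 30) ⟩
    32 * T'            ≡⟨ *-comm 32 T' ⟩
    T' * 2 ^ 5         ∎)
    where
    open ≤-Reasoning
    T' : ℕ
    T' = tower (suc s)

infix 4 _∈ᵇ_
_∈ᵇ_ : Word → List Word → Bool
v ∈ᵇ ws = any (λ u → ⌊ v ≟ʷ u ⌋) ws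

∈ᵇ-++ : ∀ v us ws → (v ∈ᵇ us ++ ws) ≡ (v ∈ᵇ us) ∨ (v ∈ᵇ ws)
∈ᵇ-++ v []       ws = refl
∈ᵇ-++ v (u ∷ us) ws with v ≟ʷ u
... | yes _ = refl
... | no  _ = ∈ᵇ-++ v us ws

∈ᵇ-length : ∀ v ws → All (λ w → ∣ v ∣ ≢ ∣ w ∣) ws → (v ∈ᵇ ws) ≡ false
∈ᵇ-length v []       []       = refl
∈ᵇ-length v (w ∷ ws) (p ∷ ps) with v ≟ʷ w
... | yes refl = ⊥-elim (p refl)
... | no _     = ∈ᵇ-length v ws ps

witness : Bool → Word → Word
witness b z = b ∷ false ∷ false ∷ z

tails : Bool → List Word → List Word
tails b []             = []
tails b ([] ∷ ds)      = tails b ds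
tails b ((c ∷ u) ∷ ds) = if ⌊ b ≟ᵇ c ⌋ then u ∷ tails b ds else tails b ds

tails-length : ∀ ds → length (tails true ds) + length (tails false ds) ≤ length ds
tails-length []                 = z≤n
tails-length ([] ∷ ds)          = ≤-trans (tails-length ds) (n≤1+n _)
tails-length ((true ∷ u) ∷ ds)  = s≤s (tails-length ds)
tails-length ((false ∷ u) ∷ ds) = ≤-trans (≤-reflexive (+-suc _ _)) (s≤s (tails-length ds))

∈-tails : ∀ b z ds → b ∷ z ∈ ds → z ∈ tails b ds
∈-tails true  z (_ ∷ ds)           (here refl) = here refl
∈-tails false z (_ ∷ ds)           (here refl) = here refl
∈-tails b     z ([] ∷ ds)          (there i)   = ∈-tails b z ds i
∈-tails true  z ((true ∷ _) ∷ ds)  (there i)   = there (∈-tails true z ds i)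
∈-tails true  z ((false ∷ _) ∷ ds) (there i)   = ∈-tails true z ds i
∈-tails false z ((true ∷ _) ∷ ds)  (there i)   = ∈-tails false z ds i
∈-tails false z ((false ∷ _) ∷ ds) (there i)   = there (∈-tails false z ds i)

-- Pigeonhole by bisection: of the words in `ds` that begin with a given bit, there are fewer than
-- `2 ^ m` for one of the two bits, and the search goes on among their tails.
fresh : ∀ m ds → length ds < 2 ^ m → ∃[ z ] ∣ z ∣ ≡ m × ¬ z ∈ ds
fresh zero    []       p        = [] , refl , λ ()
fresh zero    (_ ∷ ds) (s≤s ())
fresh (suc m) ds p with length (tails true ds) <? 2 ^ m
... | yes q with fresh m (tails true ds) q
... | z , len , z∉ = true ∷ z , cong suc len , λ i → z∉ (∈-tails true z ds i)
fresh (suc m) ds p | no ¬q with fresh m (tails false ds) q'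
  where
  q' : length (tails false ds) < 2 ^ m
  q' = +-cancelˡ-< (2 ^ m) _ _ (≤-trans (s≤s (+-monoˡ-≤ _ (≮⇒≥ ¬q)))
    (≤-trans (s≤s (tails-length ds)) (≤-trans p (+-monoʳ-≤ (2 ^ m) (≤-reflexive (+-identityʳ _))))))
... | z , len , z∉ = false ∷ z , cong suc len , λ i → z∉ (∈-tails false z ds i)

fresh-witness : ∀ b m ds → length ds < 2 ^ m → ∃[ z ] ∣ z ∣ ≡ m × ¬ witness b z ∈ ds
fresh-witness b m ds p with fresh m (map (drop 3) ds) (≤-trans (s≤s (≤-reflexive (length-map (drop 3) ds))) p)
... | z , len , z∉ = z , len , λ i → z∉ (∈-map⁺ (drop 3) i)

admitted-block : ∀ s j ℓ → ℓ < stageLen (suc s) → admitted j ℓ ≡ true → j < block s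
admitted-block s j ℓ ℓ< e with admitted-elim j ℓ e
... | s' , p , q = ≤-trans q (block-mono (stageLen-reflects s' s (≤-trans (s≤s p) ℓ<)))

-- One stage: varying the witnesses of a single length

module Stage (s : ℕ) (base : List Word) where

  oracle : List Word → Oracle
  oracle ws = Ext (_∈ᵇ ws ++ base)

  OfStage : List Word → Set
  OfStage = All (λ w → ∣ w ∣ ≡ stageLen s)

  -- No relevant transducer is caught by a code that is longer than `stageLen s` but not than `ℓ`.
  -- Since the oracle below `stageLen s` is common to all settings, the trust is then common to all
  -- stable ones.
  record Stable (ws : List Word) (ℓ : ℕ) : Set where
    constructor stably
    field
      stays : ∀ j → j < block s → dead (oracle ws) j ℓ ≡ true → dead (oracle ws) j (stageLen s) ≡ true
  open Stable

  Agree : List Word → List Word → List Word → Set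
  Agree ds ws ws' = All (λ v → (v ∈ᵇ ws') ≡ (v ∈ᵇ ws)) ds

  -- Dependence relative to stability: `ws'` may differ from `ws` wherever `depends` does not look,
  -- provided that it does not change the trust.
  record Determined (ws : List Word) (ℓ n : ℕ) (P : List Word → Set) : Set where
    constructor determinedBy
    field
      depends : List Word
      few     : length depends ≤ n
      agrees  : ∀ ws' → OfStage ws' → Stable ws' ℓ → Agree depends ws ws' → P ws'

  stable-mono : ∀ {ws ℓ ℓ'} → ℓ ≤ ℓ' → Stable ws ℓ' → Stable ws ℓ
  stable-mono {ws} p st = stably λ j j< e → stays st j j< (dead-mono (oracle ws) j p e)

  ofStage-∉ : ∀ v ws → OfStage ws → ∣ v ∣ < stageLen s → (v ∈ᵇ ws) ≡ false
  ofStage-∉ v ws o v< = ∈ᵇ-length v ws (All.map (λ e e' → <⇒≢ v< (trans e' e)) o)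

  below-start : ∀ {ws ws'} → OfStage ws → OfStage ws' → Below (stageLen s) (oracle ws) (oracle ws')
  below-start {ws} {ws'} o o' = Ext-below (_∈ᵇ ws ++ base) (_∈ᵇ ws' ++ base) (stageLen s) λ v v< →
    trans (∈ᵇ-++ v ws base) (trans
      (cong (_∨ (v ∈ᵇ base)) (trans (ofStage-∉ v ws o v<) (≡.sym (ofStage-∉ v ws' o' v<))))
      (≡.sym (∈ᵇ-++ v ws' base)))

  -- Up to `stageLen s` this is locality. Beyond, stability carries a death back to `stageLen s`,
  -- locality transfers it to the other setting, and monotonicity carries it forward again.
  dead-stable : ∀ {ws ws' ℓ} → OfStage ws → OfStage ws' → Stable ws ℓ → Stable ws' ℓ →
    ∀ j k → j < block s → k ≤ ℓ → dead (oracle ws') j k ≡ dead (oracle ws) j k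
  dead-stable {ws} {ws'} {ℓ} o o' st st' j k j< k≤ with k ≤? stageLen s
  ... | yes p = dead-local j k (below-weaken p (below-start o' o))
  ... | no ¬p = bool-≡ (go o' o st') (go o o' st)
    where
    go : ∀ {ws ws'} → OfStage ws → OfStage ws' → Stable ws ℓ → dead (oracle ws) j k ≡ true → dead (oracle ws') j k ≡ true
    go {ws} {ws'} o o' st e = dead-mono (oracle ws') j (<⇒≤ (≰⇒> ¬p))
      (trans (≡.sym (dead-local j (stageLen s) (below-start o o'))) (stays st j j< (dead-mono (oracle ws) j k≤ e)))

  padded-determined : ∀ A → (∀ {O O'} y → Below ∣ y ∣ O O' → A O y ≡ A O' y) →
    ∀ {ws ws'} → OfStage ws → OfStage ws' → ∀ t x → t < stageLen (suc s) →
    padded A (oracle ws') t x ≡ padded A (oracle ws) t x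
  padded-determined A A-local o o' t x t< with stageLen ∣ x ∣ ≤ᵇ t in e
  ... | false = refl
  ... | true = cong (λ a → if not a then x else []) (A-local x (below-weaken x≤ (below-start o' o)))
    where
    x≤ : ∣ x ∣ ≤ stageLen s
    -- The padding yields `stageLen ∣ x ∣ < stageLen (suc s)`, hence `∣ x ∣ ≤ s`, far below the
    -- lengths of this stage.
    x≤ = ≤-trans (stageLen-reflects ∣ x ∣ s (≤-trans (s≤s (≤ᵇ-true e)) t<)) (<⇒≤ (s<stageLen s))

  collect : ∀ {ws ℓ} qs → All (λ q → Determined ws ℓ ∣ q ∣ (λ ws' → oracle ws' q ≡ oracle ws q)) qs →
    Determined ws ℓ (sum (map length qs)) (λ ws' → All (λ q → oracle ws' q ≡ oracle ws q) qs)
  collect []       []                              = determinedBy [] z≤n λ _ _ _ _ → []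
  collect (q ∷ qs) (determinedBy ds len h ∷ hs) with collect qs hs
  ... | determinedBy ds' len' h' =
    determinedBy (ds ++ ds') (≤-trans (≤-reflexive (length-++ ds)) (+-mono-≤ len len'))
    λ ws' o st a → h ws' o st (All.++⁻ˡ ds a) ∷ h' ws' o st (All.++⁻ʳ ds a)

  uses-determined : ∀ {ws k ℓ n P} → (∀ q → ∣ q ∣ < k → Determined ws ℓ ∣ q ∣ (λ ws' → oracle ws' q ≡ oracle ws q)) →
    Uses k n (oracle ws) P → Determined ws ℓ n (λ ws' → P (oracle ws'))
  uses-determined det (uses qs short total holds) with collect qs (All.map (λ {q} → det q) short)
  ... | determinedBy ds len h = determinedBy ds (≤-trans len total) λ ws' o st a → holds (oracle ws') (h ws' o st a)

  module _ {ws : List Word} {ℓ : ℕ} (ofStage : OfStage ws) (ℓ< : ℓ < stageLen (suc s)) (stable : Stable ws ℓ) where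

    private
      O : Oracle
      O = oracle ws

    hf-determined : ∀ w → ∣ w ∣ ≤ ℓ → (∀ q → ∣ q ∣ < ∣ w ∣ → Determined ws ℓ ∣ q ∣ (λ ws' → oracle ws' q ≡ O q)) →
      Determined ws ℓ ∣ w ∣ (λ ws' → hf (oracle ws') w ≡ hf O w)
    hf-determined w w≤ det = go (parse w) (parse-length {w} refl)
      where
      go : ∀ p → proj₁ p + (proj₁ (proj₂ p) + ∣ proj₂ (proj₂ p) ∣) ≤ ∣ w ∣ →
        Determined ws ℓ ∣ w ∣ (λ ws' → (hf₃ (oracle ws') ∣ w ∣ p) ≡ (hf₃ O ∣ w ∣ p))
      go (zero , t , x) len = determinedBy [] z≤n λ ws' o st _ →
        padded-determined inC inC-local ofStage o t x (≤-trans (s≤s (≤-trans (m≤m+n t _) (≤-trans len w≤))) ℓ<)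
      go (suc j , t , x) len with admitted j ∣ w ∣ in e
      ... | false = determinedBy [] z≤n λ _ _ _ _ → refl
      ... | true with uses-determined det (uses-weaken t< ≤-refl (transduce-uses O j t x))
        where
        t< : t < ∣ w ∣
        t< = ≤-trans (s≤s (≤-trans (m≤m+n t _) (m≤n+m _ j))) len
      ... | determinedBy ds len' h = determinedBy ds (≤-trans len' t≤) λ ws' o st a →
        cong₂ (λ A y → if not A then fromMaybe [] y else [])
          (dead-stable ofStage o stable st j ∣ w ∣ (admitted-block s j ∣ w ∣ (≤-trans (s≤s w≤) ℓ<) e) w≤)
          (h ws' o st a)
        where
        t≤ : t ≤ ∣ w ∣
        t≤ = ≤-trans (m≤m+n t _) (≤-trans (m≤n+m _ (suc j)) len)

    hg-determined : ∀ k w → ∣ w ∣ ≤ ℓ → ∀ ws' → OfStage ws' → hg (oracle ws') k w ≡ hg O k w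
    hg-determined k w w≤ ws' o = go (parse w) (parse-length {w} refl)
      where
      go : ∀ p → proj₁ p + (proj₁ (proj₂ p) + ∣ proj₂ (proj₂ p) ∣) ≤ ∣ w ∣ → hg₃ (oracle ws') k p ≡ hg₃ O k p
      go (zero , t , x) len =
        padded-determined inD inD-local ofStage o t x (≤-trans (s≤s (≤-trans (m≤m+n t _) (≤-trans len w≤))) ℓ<)
      go (suc s' , t , x) len = refl

    stored-determined : ∀ e w → ∣ w ∣ ≤ ℓ → (∀ q → ∣ q ∣ < ∣ w ∣ → Determined ws ℓ ∣ q ∣ (λ ws' → oracle ws' q ≡ O q)) →
      Determined ws ℓ ∣ w ∣ (λ ws' → stored (oracle ws') e w ≡ stored O e w)
    stored-determined zero    w w≤ det = hf-determined w w≤ det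
    stored-determined (suc e) w w≤ det with unpair e
    ... | zero  , k = determinedBy [] z≤n λ ws' o _ _ → hg-determined k w w≤ ws' o
    ... | suc _ , k = determinedBy [] z≤n λ _ _ _ _ → refl

    -- A free witness depends on itself alone. A bit of `hf` depends, by the common trust, only on
    -- the simulated run, whose queries have a total length of at most the time written in the code,
    -- so the induction hypotheses for them add up to at most `∣ v ∣`. The number `k` is fuel for
    -- the induction on length.
    determined : ∀ k v → ∣ v ∣ < k → ∣ v ∣ ≤ ℓ → Determined ws ℓ ∣ v ∣ (λ ws' → oracle ws' v ≡ O v)
    determined (suc k) []      v<k       v≤ = determinedBy [] z≤n λ ws' o _ _ → below-start o ofStage [] (s≤s z≤n)
    determined (suc k) (c ∷ r) (s≤s v<k) v≤ with go (parse r) refl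
      where
      go : ∀ p → parse r ≡ p → Determined ws ℓ (suc ∣ r ∣) (λ ws' →
        answer₃ (_∈ᵇ ws' ++ base) (oracle ws') (c ∷ r) c p ≡ answer₃ (_∈ᵇ ws ++ base) O (c ∷ r) c p)
      go (i , zero , z) e = determinedBy ((c ∷ r) ∷ []) (s≤s z≤n) λ { ws' _ _ (a ∷ []) →
        trans (∈ᵇ-++ (c ∷ r) ws' base) (trans (cong (_∨ ((c ∷ r) ∈ᵇ base)) a) (≡.sym (∈ᵇ-++ (c ∷ r) ws base))) }
      go (i , suc x , z) e with stored-determined x (reverse z) (≤-trans z≤ (≤-trans (n≤1+n _) v≤))
        (λ q q< → determined k q (≤-trans q< (≤-trans z≤ (≤-trans (n≤1+n _) v<k))) (≤-trans (<⇒≤ q<) (≤-trans z≤ (≤-trans (n≤1+n _) v≤))))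
        where
        z≤ : ∣ reverse z ∣ ≤ ∣ r ∣
        z≤ = argument-length {r} e
      ... | determinedBy ds len h = determinedBy ds (≤-trans len (≤-trans (argument-length {r} e) (n≤1+n _)))
        λ ws' o st a → cong (readBit c i) (h ws' o st a)
    ... | determinedBy ds len h = determinedBy ds len λ ws' o st a →
      trans (Ext-answer (_∈ᵇ ws' ++ base) (c ∷ r)) (trans (h ws' o st a) (≡.sym (Ext-answer (_∈ᵇ ws ++ base) (c ∷ r))))

    -- A code of length `suc ℓ` asks queries of length at most `ℓ`, so stability up to `ℓ` is enough
    -- to analyse it. This gain of one drives the induction in `single-stable`.
    run-determined : ∀ {n P} → Uses (suc ℓ) n O P → Determined ws ℓ n (λ ws' → P (oracle ws'))
    run-determined = uses-determined λ q q< → determined (suc ∣ q ∣) q ≤-refl (≤-pred q<)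

  Paired : List Word → Set
  Paired ws = ws ≡ [] ⊎ (∃[ z₀ ] ∃[ z₁ ] ∣ z₀ ∣ ≡ witnessLen s × ∣ z₁ ∣ ≡ witnessLen s ×
    ws ≡ witness false z₀ ∷ witness true z₁ ∷ [])

  single-ofStage : ∀ b {z} → ∣ z ∣ ≡ witnessLen s → OfStage (witness b z ∷ [])
  single-ofStage b e = cong (3 +_) e ∷ []

  ∈ᵇ-append : ∀ v ws w → v ≢ w → (v ∈ᵇ ws ++ w ∷ []) ≡ (v ∈ᵇ ws)
  ∈ᵇ-append v [] w v≢w with v ≟ʷ w
  ... | yes e = ⊥-elim (v≢w e)
  ... | no _  = refl
  ∈ᵇ-append v (u ∷ ws) w v≢w with v ≟ʷ u
  ... | yes _ = refl
  ... | no _  = ∈ᵇ-append v ws w v≢w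

  agree-append : ∀ ds ws w → ¬ w ∈ ds → Agree ds ws (ws ++ w ∷ [])
  agree-append []       ws w w∉ = []
  agree-append (d ∷ ds) ws w w∉ =
    ∈ᵇ-append d ws w (λ e → w∉ (here (≡.sym e))) ∷ agree-append ds ws w (λ i → w∉ (there i))

  module _ (paired-stable : ∀ ws → Paired ws → Stable ws (stageLen (suc s))) where

    -- An accepting computation does not see most of the witnesses tagged
    -- true, and adding an unseen one turns a single witness into a pair.
    single-stable : ∀ z₀ → ∣ z₀ ∣ ≡ witnessLen s → ∀ ℓ → ℓ ≤ stageLen (suc s) → Stable (witness false z₀ ∷ []) ℓ
    single-stable z₀ len₀ zero    ℓ≤ = stably λ j j< e → dead-mono (oracle (witness false z₀ ∷ [])) j z≤n e
    single-stable z₀ len₀ (suc ℓ) ℓ≤ .stays j j< e with dead (oracle (witness false z₀ ∷ [])) j (stageLen s) in alive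
    ... | true  = refl
    ... | false with dead-elim (oracle (witness false z₀ ∷ [])) j (suc ℓ) e
    ... | w , w≤ , v with run-determined (single-ofStage false len₀) ℓ≤ (single-stable z₀ len₀ ℓ (<⇒≤ ℓ≤))
                        (uses-weaken w≤ (*-monoʳ-≤ 2 w≤) (violates-uses (oracle (witness false z₀ ∷ [])) j w v))
    ... | determinedBy ds len h with fresh-witness true (witnessLen s) ds
                        (≤-trans (s≤s (≤-trans len (*-monoʳ-≤ 2 ℓ≤))) (horizon-small s))
    ... | z₁ , len₁ , z₁∉ = ⊥-elim (true≢false revived alive)
      where
      ws' : List Word
      ws' = witness false z₀ ∷ witness true z₁ ∷ []
      o' : OfStage ws'
      o' = cong (3 +_) len₀ ∷ cong (3 +_) len₁ ∷ []
      st' : Stable ws' (stageLen (suc s))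
      st' = paired-stable ws' (inj₂ (z₀ , z₁ , len₀ , len₁ , refl))
      v' : violates (oracle ws') j w ≡ true
      v' = h ws' o' (stable-mono (<⇒≤ ℓ≤) st') (agree-append ds (witness false z₀ ∷ []) (witness true z₁) z₁∉)
      revived : dead (oracle (witness false z₀ ∷ [])) j (stageLen s) ≡ true
      revived = trans (dead-local j (stageLen s) (below-start (single-ofStage false len₀) o'))
        (stays st' j j< (dead-intro (oracle ws') j w (≤-trans w≤ ℓ≤) v'))

    -- The run sees at most `horizon s` witnesses, fewer than there are with tag `false`. An unseen
    -- one can be added without affecting the run because both settings, the empty one and the
    -- single one, are stable.
    refutable : ∀ k u {y} → transduce (oracle []) k (horizon s) u ≡ just y →
      ∃[ z₀ ] ∣ z₀ ∣ ≡ witnessLen s × transduce (oracle (witness false z₀ ∷ [])) k (horizon s) u ≡ just y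
    refutable k u {y} e with run-determined [] ≤-refl (stable-mono (n≤1+n _) (paired-stable [] (inj₁ refl)))
                          (transduce-uses (oracle []) k (horizon s) u)
    ... | determinedBy ds len h with fresh-witness false (witnessLen s) ds
                          (≤-trans (s≤s (≤-trans len (≤-trans (n≤1+n _) (m≤m+n _ _)))) (horizon-small s))
    ... | z₀ , len₀ , z₀∉ = z₀ , len₀ , trans
      (h (witness false z₀ ∷ []) (single-ofStage false len₀) (single-stable z₀ len₀ (horizon s) (n≤1+n _))
        (agree-append ds [] (witness false z₀) z₀∉)) e

-- The choice made at a stage

pick : {A : Set} → (A → Bool) → List A → Maybe A
pick p []       = nothing
pick p (x ∷ xs) = if p x then just x else pick p xs

pick-just : ∀ {A : Set} (p : A → Bool) xs {x} → pick p xs ≡ just x → x ∈ xs × p x ≡ true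
pick-just p (x ∷ xs) e with p x in px
pick-just p (x ∷ xs) refl | true = here refl , px
... | false with pick-just p xs e
... | i , py = there i , py

pick-nothing : ∀ {A : Set} (p : A → Bool) xs {x} → pick p xs ≡ nothing → x ∈ xs → p x ≡ false
pick-nothing p (x ∷ xs) e i with p x in px
pick-nothing p (x ∷ xs) e (here refl) | false = px
pick-nothing p (x ∷ xs) e (there i)   | false = pick-nothing p xs e i

guesses : ℕ → List Word
guesses s = filter (λ z → ∣ z ∣ ≟ witnessLen s) (wordsUpTo (witnessLen s))

guesses-complete : ∀ s {z} → ∣ z ∣ ≡ witnessLen s → z ∈ guesses s
guesses-complete s e =
  ∈-filter⁺ (λ z → ∣ z ∣ ≟ witnessLen s) (wordsUpTo-complete (witnessLen s) (≤-reflexive e)) e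

guesses-sound : ∀ s {z} → z ∈ guesses s → ∣ z ∣ ≡ witnessLen s
guesses-sound s i = proj₂ (∈-filter⁻ (λ z → ∣ z ∣ ≟ witnessLen s) {xs = wordsUpTo (witnessLen s)} i)

pairing : Word → Word → List Word
pairing z₀ z₁ = witness false z₀ ∷ witness true z₁ ∷ []

settings : ℕ → List (List Word)
settings s = [] ∷ cartesianProductWith pairing (guesses s) (guesses s)

unstable : ℕ → List Word → List Word → Bool
unstable s base ws =
  anyBelow (λ j → dead (Stage.oracle s base ws) j (stageLen (suc s)) ∧ not (dead (Stage.oracle s base ws) j (stageLen s)))
    (block s)

isHard : ℕ → Maybe Word → Bool
isHard s nothing  = false
isHard s (just y) = ⌊ y ≟ʷ hard s ⌋

refutes : ℕ → List Word → Word → Bool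
refutes s base z₀ =
  any (λ u → isHard s (transduce (Stage.oracle s base (witness false z₀ ∷ [])) (target s) (horizon s) u))
    (wordsUpTo (horizon s))

choose₂ : Maybe (List Word) → Maybe Word → List Word
choose₂ (just ws) _         = ws
choose₂ nothing   (just z₀) = witness false z₀ ∷ []
choose₂ nothing   nothing   = []

choose : ℕ → List Word → List Word
choose s base = choose₂ (pick (unstable s base) (settings s)) (pick (refutes s base) (guesses s))

data Outcome (s : ℕ) (base : List Word) : List Word → Set where
  kills : ∀ {ws} j → Stage.Paired s base ws → j < block s →
    dead (Stage.oracle s base ws) j (stageLen (suc s)) ≡ true →
    dead (Stage.oracle s base ws) j (stageLen s) ≡ false → Outcome s base ws
  refuted : ∀ z₀ u → ∣ z₀ ∣ ≡ witnessLen s →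
    transduce (Stage.oracle s base (witness false z₀ ∷ [])) (target s) (horizon s) u ≡ just (hard s) →
    Outcome s base (witness false z₀ ∷ [])
  waits : (∀ u → ∣ u ∣ ≤ horizon s → transduce (Stage.oracle s base []) (target s) (horizon s) u ≢ just (hard s)) →
    Outcome s base []

outcome : ∀ s base → Outcome s base (choose s base)
outcome s base with pick (unstable s base) (settings s) in e₁
... | just ws with pick-just (unstable s base) (settings s) e₁
... | i , un with anyBelow-sound _ (block s) un
... | j , j< , e with ∧-true {dead (Stage.oracle s base ws) j (stageLen (suc s))} e
... | d , ¬d = kills j (paired i) j< d (not-true ¬d)
  where
  paired : ∀ {ws} → ws ∈ settings s → Stage.Paired s base ws
  paired (here refl) = inj₁ refl
  paired (there i) with ∈-cartesianProductWith⁻ pairing (guesses s) (guesses s) i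
  ... | z₀ , z₁ , i₀ , i₁ , e = inj₂ (z₀ , z₁ , guesses-sound s i₀ , guesses-sound s i₁ , e)
outcome s base | nothing with pick (refutes s base) (guesses s) in e₂
... | just z₀ with pick-just (refutes s base) (guesses s) e₂
... | i , r with ∈-any _ (wordsUpTo (horizon s)) r
... | u , _ , hit = refuted z₀ u (guesses-sound s i) (isHard-just hit)
  where
  isHard-just : ∀ {y} → isHard s y ≡ true → y ≡ just (hard s)
  isHard-just {just y} e = cong just (⌊⌋-true {d = y ≟ʷ hard s} e)
outcome s base | nothing | nothing = waits never
  where
  open Stage s base
  -- No setting was picked as unstable, and `settings` lists all the paired ones; this is the
  -- hypothesis of `refutable`.
  stable : ∀ ws → Paired ws → Stable ws (stageLen (suc s))
  stable ws p .Stable.stays j j< d with dead (oracle ws) j (stageLen s) in a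
  ... | true  = refl
  ... | false = ⊥-elim (true≢false
    (anyBelow-complete (λ j → dead (oracle ws) j (stageLen (suc s)) ∧ not (dead (oracle ws) j (stageLen s)))
      (block s) j< (both d a))
    (pick-nothing (unstable s base) (settings s) e₁ (listed p)))
    where
    both : ∀ {a b} → a ≡ true → b ≡ false → a ∧ not b ≡ true
    both refl refl = refl
    listed : Paired ws → ws ∈ settings s
    listed (inj₁ refl) = here refl
    listed (inj₂ (z₀ , z₁ , len₀ , len₁ , refl)) =
      there (∈-cartesianProductWith⁺ pairing (guesses-complete s len₀) (guesses-complete s len₁))
  never : ∀ u → ∣ u ∣ ≤ horizon s → transduce (oracle []) (target s) (horizon s) u ≢ just (hard s)
  never u u≤ e with refutable stable (target s) u e
  ... | z₀ , len₀ , e' = true≢false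
    (any-∈ (λ u → isHard s (transduce (oracle (witness false z₀ ∷ [])) (target s) (horizon s) u)) {u}
      (wordsUpTo (horizon s)) (wordsUpTo-complete (horizon s) u≤)
      (trans (cong (isHard s) e') (≟ʷ-refl (hard s))))
    (pick-nothing (refutes s base) (guesses s) e₂ (guesses-complete s len₀))

-- The final oracle

history : ℕ → List Word
history zero    = []
history (suc s) = choose s (history s) ++ history s

chosen : ℕ → List Word
chosen s = choose s (history s)

outcome-ofStage : ∀ {s base ws} → Outcome s base ws → Stage.OfStage s base ws
outcome-ofStage (kills j (inj₁ refl) _ _ _) = []
outcome-ofStage (kills j (inj₂ (z₀ , z₁ , len₀ , len₁ , refl)) _ _ _) = cong (3 +_) len₀ ∷ cong (3 +_) len₁ ∷ []
outcome-ofStage (refuted z₀ u len₀ _) = cong (3 +_) len₀ ∷ []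
outcome-ofStage (waits _) = []

chosen-ofStage : ∀ s → Stage.OfStage s (history s) (chosen s)
chosen-ofStage s = outcome-ofStage (outcome s (history s))

stageLen-< : ∀ s → stageLen s < stageLen (suc s)
stageLen-< s = +-monoʳ-< 3 (+-monoˡ-< 5 (n<2^n (tower s)))

history-short : ∀ s → All (λ w → ∣ w ∣ < stageLen s) (history s)
history-short zero    = []
history-short (suc s) = All.++⁺
  (All.map (λ e → subst (_< stageLen (suc s)) (≡.sym e) (stageLen-< s)) (chosen-ofStage s))
  (All.map (λ p → ≤-trans p (<⇒≤ (stageLen-< s))) (history-short s))

history-stable : ∀ v {s s'} → ∣ v ∣ < stageLen s → s ≤ s' → (v ∈ᵇ history s') ≡ (v ∈ᵇ history s)
history-stable v {s} v< s≤s' = go (≤⇒≤′ s≤s')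
  where
  go : ∀ {s'} → s ≤′ s' → (v ∈ᵇ history s') ≡ (v ∈ᵇ history s)
  go ≤′-refl          = refl
  go (≤′-step {s'} p) = trans (∈ᵇ-++ v (chosen s') (history s'))
    (trans (cong (_∨ (v ∈ᵇ history s'))
      (Stage.ofStage-∉ s' (history s') v (chosen s') (chosen-ofStage s') (≤-trans v< (stageLen-mono (≤′⇒≤ p)))))
      (go p))

-- The union of all histories, decided at a finite stage: a stage numbered above `∣ v ∣` adds only
-- words longer than `v`.
witnesses : Word → Bool
witnesses v = v ∈ᵇ history (suc ∣ v ∣)

witnesses-history : ∀ v s → ∣ v ∣ < stageLen s → witnesses v ≡ (v ∈ᵇ history s)
witnesses-history v s v< with ≤-total s (suc ∣ v ∣)
... | inj₁ p = history-stable v v< p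
... | inj₂ p = ≡.sym (history-stable v (<⇒≤ (s<stageLen (suc ∣ v ∣))) p)

𝒪 : Oracle
𝒪 = Ext witnesses

𝒪-stage : ∀ s → Below (stageLen (suc s)) 𝒪 (Stage.oracle s (history s) (chosen s))
𝒪-stage s = Ext-below witnesses (_∈ᵇ history (suc s)) (stageLen (suc s)) λ v → witnesses-history v (suc s)

𝒪-witness : ∀ s b z → ∣ z ∣ ≡ witnessLen s → 𝒪 (witness b z) ≡ (witness b z ∈ᵇ chosen s)
𝒪-witness s b z len =
  trans (Ext-answer witnesses (witness b z))
  (trans (witnesses-history (witness b z) (suc s) (subst (_< stageLen (suc s)) (≡.sym len') (stageLen-< s)))
  (trans (∈ᵇ-++ (witness b z) (chosen s) (history s))
  (trans (cong ((witness b z ∈ᵇ chosen s) ∨_) (∈ᵇ-length (witness b z) (history s)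
    (All.map (λ p e → <⇒≢ p (trans (≡.sym e) len')) (history-short s))))
  (∨-identityʳ _))))
  where
  len' : ∣ witness b z ∣ ≡ stageLen s
  len' = cong (3 +_) len

𝒪-stored : ∀ e w b i → 𝒪 (b ∷ unary i (unary (suc e) (reverse w))) ≡ readBit b i (stored 𝒪 e w)
𝒪-stored e w b i = trans (Ext-answer witnesses (b ∷ unary i (unary (suc e) (reverse w))))
  (trans (cong (answer₃ witnesses 𝒪 (b ∷ unary i (unary (suc e) (reverse w))) b) (parse-unary i (suc e) (reverse w)))
    (cong (λ x → readBit b i (stored 𝒪 e x)) (reverse-involutive w)))

-- A machine that reads a stored function

-- The exact number of steps is hidden below a bound, and the equation holds for every remaining
-- time `t`; this is what lets segments of a run be composed by adding their bounds.
record Reach (O : Oracle) (M : Machine) (n : ℕ) (c c' : Config) : Set where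
  constructor reach
  field
    time  : ℕ
    quick : time ≤ n
    runs  : ∀ t → runD O M (time + t) c ≡ runD O M t c'

module _ {O : Oracle} {M : Machine} where

  stop : ∀ {c} → Reach O M 0 c c
  stop = reach 0 z≤n λ _ → refl

  step : ∀ {c c'} → (∀ t → runD O M (suc t) c ≡ runD O M t c') → Reach O M 1 c c'
  step e = reach 1 ≤-refl e

  infixr 5 _▷_
  _▷_ : ∀ {m n c₁ c₂ c₃} → Reach O M m c₁ c₂ → Reach O M n c₂ c₃ → Reach O M (m + n) c₁ c₃
  _▷_ {c₁ = c₁} (reach t p e) (reach t' p' e') = reach (t + t') (+-mono-≤ p p')
    λ t'' → trans (cong (λ k → runD O M k c₁) (+-assoc t t' t'')) (trans (e (t' + t'')) (e' t''))

  within : ∀ {m n c c'} → m ≤ n → Reach O M m c c' → Reach O M n c c'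
  within m≤n (reach t p e) = reach t (≤-trans p m≤n) e

  arriving : ∀ {n c c₁ c₂} → c₁ ≡ c₂ → Reach O M n c c₁ → Reach O M n c c₂
  arriving refl r = r

countdown : ℕ → Machine
countdown zero    = rule 12 0 7 5 S (just true) ∷ []
countdown (suc c) = rule (13 + c) 0 (12 + c) 2 R nothing ∷ countdown c

-- The tape holds u # y, where u = w01ᶜ, y is the part of the output found so
-- far, # is the symbol 5, and the first cell is marked (3 or 4 for a bit 0 or
-- 1); while the next bit of y is being asked for, its place holds a 6.
-- States 7 and 8 write the query from right to left over y and u, states 9
-- and 10 return with a positive or negative answer, and 11 goes back to #.
reader : ℕ → Machine
reader c =
  rule 0 1 6 3 R nothing ∷
  rule 0 2 6 4 R nothing ∷
  rule 0 0 (12 + c) 3 R nothing ∷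
  rule 6 1 6 1 R nothing ∷
  rule 6 2 6 2 R nothing ∷
  rule 6 0 (12 + c) 1 R nothing ∷
  rule 7 1 7 1 L (just true) ∷
  rule 7 2 7 2 L (just true) ∷
  rule 7 5 8 5 L (just false) ∷
  rule 8 1 8 1 L (just false) ∷
  rule 8 2 8 2 L (just true) ∷
  rule 8 3 3 3 S (just false) ∷
  rule 8 4 3 4 S (just true) ∷
  rule 4 3 9 3 R nothing ∷
  rule 4 4 9 4 R nothing ∷
  rule 5 3 10 3 R nothing ∷
  rule 5 4 10 4 R nothing ∷
  rule 9 1 9 1 R nothing ∷
  rule 9 2 9 2 R nothing ∷
  rule 9 5 9 5 R nothing ∷
  rule 9 6 7 2 S (just true) ∷
  rule 9 0 7 6 L (just false) ∷
  rule 10 1 10 1 R nothing ∷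
  rule 10 2 10 2 R nothing ∷
  rule 10 5 10 5 R nothing ∷
  rule 10 6 7 1 S (just true) ∷
  rule 10 0 11 0 L nothing ∷
  rule 11 1 11 1 L nothing ∷
  rule 11 2 11 2 L nothing ∷
  rule 11 5 1 5 R nothing ∷
  countdown c

mark : Bool → ℕ
mark false = 3
mark true  = 4

leftward : ℕ → List ℕ → List ℕ → List Bool → Config
leftward s []      r q = config s [] 0 r q
leftward s (h ∷ l) r q = config s l h r q

rightward : ℕ → List ℕ → List ℕ → List Bool → Config
rightward s l []      q = config s l 0 [] q
rightward s l (h ∷ r) q = config s l h r q

trues : ℕ → List Bool → List Bool
trues zero    q = q
trues (suc n) q = trues n (true ∷ q)

data Plain : ℕ → Set where
  bit₀  : Plain 1
  bit₁  : Plain 2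
  sharp : Plain 5

sym-plain : ∀ b → Plain (sym b)
sym-plain false = bit₀
sym-plain true  = bit₁

returning : Bool → ℕ
returning true  = 9
returning false = 10

countdown-step : ∀ c i l → i ≤ c → fire (countdown c) (config (12 + i) l 0 [] []) ≡
  just (if i ≡ᵇ 0 then config 7 l 5 [] (true ∷ []) else config (11 + i) (2 ∷ l) 0 [] [])
countdown-step zero    zero    l p = refl
countdown-step (suc c) i       l p with i ≟ suc c
countdown-step (suc c) .(suc c) l p | yes refl with c ≡ᵇ c | ≡⇒≡ᵇ c c refl
... | true | _ = refl
countdown-step (suc c) i       l p | no ¬e with suc c ≡ᵇ i in e
... | true  = ⊥-elim (¬e (≡.sym (≡ᵇ-true (suc c) i e)))
... | false = countdown-step c i l (≤-pred (≤∧≢⇒< p ¬e))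

module Reader (O : Oracle) (c : ℕ) where

  M : Machine
  M = reader c

  _⟶[_]_ : Config → ℕ → Config → Set
  c₁ ⟶[ n ] c₂ = Reach O M n c₁ c₂

  counted : ∀ i l → i ≤ c → config (12 + i) l 0 [] [] ⟶[ suc i ]
    config 7 (map sym (replicate i true) ++ l) 5 [] (true ∷ [])
  counted zero    l p = step λ t → cong (_>>= runD O M t) (trans (goD-fire O M _ (countdown c)) (countdown-step c 0 l p))
  counted (suc i) l p = arriving (cong (λ l → config 7 l 5 [] (true ∷ [])) (shift i))
    (step (λ t → cong (_>>= runD O M t) (trans (goD-fire O M _ (countdown c)) (countdown-step c (suc i) l p)))
      ▷ counted i (2 ∷ l) (<⇒≤ p))
    where
    shift : ∀ i → map sym (replicate i true) ++ 2 ∷ l ≡ 2 ∷ map sym (replicate i true) ++ l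
    shift zero    = refl
    shift (suc i) = cong (2 ∷_) (shift i)

  skip : ∀ s b l r → s ≡ 6 → config s l (sym b) r [] ⟶[ 1 ] rightward s (sym b ∷ l) r []
  skip .6 false l []      refl = step λ _ → refl
  skip .6 false l (_ ∷ _) refl = step λ _ → refl
  skip .6 true  l []      refl = step λ _ → refl
  skip .6 true  l (_ ∷ _) refl = step λ _ → refl

  scan : ∀ bs l → rightward 6 l (map sym bs) [] ⟶[ length bs ] rightward 6 (map sym bs ʳ++ l) [] []
  scan []       l = stop
  scan (b ∷ bs) l = skip 6 b l (map sym bs) refl ▷ scan bs (sym b ∷ l)

  counting : ∀ b a l r q → config 7 (a ∷ l) (sym b) r q ⟶[ 1 ] config 7 l a (sym b ∷ r) (true ∷ q)
  counting false a l r q = step λ _ → refl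
  counting true  a l r q = step λ _ → refl

  count : ∀ ys l r q → leftward 7 (map sym ys ++ 5 ∷ l) r q ⟶[ length ys ]
    leftward 7 (5 ∷ l) (map sym ys ʳ++ r) (trues (length ys) q)
  count []            l r q = stop
  count (b ∷ [])      l r q = counting b 5 l r q
  count (b ∷ b' ∷ ys) l r q =
    counting b (sym b') (map sym ys ++ 5 ∷ l) r q ▷ count (b' ∷ ys) l (sym b ∷ r) (true ∷ q)

  copying : ∀ b a l r q → config 8 (a ∷ l) (sym b) r q ⟶[ 1 ] config 8 l a (sym b ∷ r) (b ∷ q)
  copying false a l r q = step λ _ → refl
  copying true  a l r q = step λ _ → refl

  copy : ∀ vs a r q → leftward 8 (map sym vs ++ a ∷ []) r q ⟶[ length vs ]
    leftward 8 (a ∷ []) (map sym vs ʳ++ r) (vs ʳ++ q)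
  copy []            a r q = stop
  copy (b ∷ [])      a r q = copying b a [] r q
  copy (b ∷ b' ∷ vs) a r q =
    copying b (sym b') (map sym vs ++ a ∷ []) r q ▷ copy (b' ∷ vs) a (sym b ∷ r) (b ∷ q)

  passing : ∀ x l a r → Plain a → config (returning x) l a r [] ⟶[ 1 ] rightward (returning x) (a ∷ l) r []
  passing true  l .1 []      bit₀  = step λ _ → refl
  passing true  l .2 []      bit₁  = step λ _ → refl
  passing true  l .5 []      sharp = step λ _ → refl
  passing true  l .1 (_ ∷ _) bit₀  = step λ _ → refl
  passing true  l .2 (_ ∷ _) bit₁  = step λ _ → refl
  passing true  l .5 (_ ∷ _) sharp = step λ _ → refl
  passing false l .1 []      bit₀  = step λ _ → refl
  passing false l .2 []      bit₁  = step λ _ → refl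
  passing false l .5 []      sharp = step λ _ → refl
  passing false l .1 (_ ∷ _) bit₀  = step λ _ → refl
  passing false l .2 (_ ∷ _) bit₁  = step λ _ → refl
  passing false l .5 (_ ∷ _) sharp = step λ _ → refl

  return : ∀ x l as r → All Plain as → rightward (returning x) l (as ++ r) [] ⟶[ length as ]
    rightward (returning x) (as ʳ++ l) r []
  return x l []       r []       = stop
  return x l (a ∷ as) r (p ∷ ps) = passing x l a (as ++ r) p ▷ return x (a ∷ l) as r ps

  finding : ∀ b a l r → config 11 (a ∷ l) (sym b) r [] ⟶[ 1 ] config 11 l a (sym b ∷ r) []
  finding false a l r = step λ _ → refl
  finding true  a l r = step λ _ → refl

  find : ∀ ys l r → leftward 11 (map sym ys ++ 5 ∷ l) r [] ⟶[ length ys ] leftward 11 (5 ∷ l) (map sym ys ʳ++ r) []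
  find []            l r = stop
  find (b ∷ [])      l r = finding b 5 l r
  find (b ∷ b' ∷ ys) l r = finding b (sym b') (map sym ys ++ 5 ∷ l) r ▷ find (b' ∷ ys) l (sym b ∷ r)

  sharpen : ∀ vs a r q → config 7 (map sym vs ++ a ∷ []) 5 r q ⟶[ 1 ] leftward 8 (map sym vs ++ a ∷ []) (5 ∷ r) (false ∷ q)
  sharpen []       a r q = step λ _ → refl
  sharpen (_ ∷ vs) a r q = step λ _ → refl

  asked : Bool → ℕ → List Bool → Bool → Word
  asked b n vs b₀ = b ∷ unary n (vs ++ b₀ ∷ [])

  -- The head collects the tape from right to left, so the bits found so far come first as a unary
  -- index, then the number of the function, and the argument last and backwards. This is why the
  -- oracle reverses the argument.
  asked-query : ∀ b n vs b₀ → reverse (b₀ ∷ (vs ʳ++ false ∷ trues n (b ∷ []))) ≡ asked b n vs b₀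
  asked-query b n vs b₀ = trans (ʳ++-ʳ++ vs) (trans (trues-unary n 0 (b ∷ [])) (cong (λ k → b ∷ unary k (vs ++ b₀ ∷ [])) (+-identityʳ n)))
    where
    trues-unary : ∀ n m q → trues n q ʳ++ unary m (vs ++ b₀ ∷ []) ≡ q ʳ++ unary (n + m) (vs ++ b₀ ∷ [])
    trues-unary zero    m q = refl
    trues-unary (suc n) m q = trues-unary n m (true ∷ q)

  asking-head : ∀ b₀ r q → config 8 [] (mark b₀) r q ⟶[ 1 ] config 3 [] (mark b₀) r (b₀ ∷ q)
  asking-head false r q = step λ _ → refl
  asking-head true  r q = step λ _ → refl

  answered : ∀ x b₀ r → config (if x then 4 else 5) [] (mark b₀) r [] ⟶[ 1 ]
    rightward (returning x) (mark b₀ ∷ []) r []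
  answered true  false []      = step λ _ → refl
  answered true  false (_ ∷ _) = step λ _ → refl
  answered true  true  []      = step λ _ → refl
  answered true  true  (_ ∷ _) = step λ _ → refl
  answered false false []      = step λ _ → refl
  answered false false (_ ∷ _) = step λ _ → refl
  answered false true  []      = step λ _ → refl
  answered false true  (_ ∷ _) = step λ _ → refl

  ask : ∀ b₀ r q x → O (reverse (b₀ ∷ q)) ≡ x →
    config 8 [] (mark b₀) r q ⟶[ 3 ] rightward (returning x) (mark b₀ ∷ []) r []
  ask b₀ r q x e = asking-head b₀ r q
    ▷ arriving (cong (λ y → config (if y then 4 else 5) [] (mark b₀) r []) e) (step λ _ → refl)
    ▷ answered x b₀ r

  map-sym-plain : ∀ bs → All Plain (map sym bs)
  map-sym-plain []       = []
  map-sym-plain (b ∷ bs) = sym-plain b ∷ map-sym-plain bs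

  plain-ʳ++ : ∀ {as r} → All Plain as → All Plain r → All Plain (as ʳ++ r)
  plain-ʳ++ []       ps' = ps'
  plain-ʳ++ (p ∷ ps) ps' = plain-ʳ++ ps (p ∷ ps')

  ʳ++-++ : ∀ (as r r' : List ℕ) → as ʳ++ (r ++ r') ≡ (as ʳ++ r) ++ r'
  ʳ++-++ []       r r' = refl
  ʳ++-++ (a ∷ as) r r' = ʳ++-++ as (a ∷ r) r'

  length-ʳ++ : ∀ (as r : List ℕ) → length (as ʳ++ r) ≡ length as + length r
  length-ʳ++ []       r = refl
  length-ʳ++ (a ∷ as) r = trans (length-ʳ++ as (a ∷ r)) (+-suc (length as) (length r))

  module _ (vs : Word) (b₀ : Bool) where

    cells : Word → List ℕ
    cells ys = map sym ys ++ 5 ∷ map sym vs ++ mark b₀ ∷ []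

    cost : ℕ → ℕ
    cost n = 2 * (n + length vs) + 5

    consult : ∀ b ys r x → O (asked b (length ys) vs b₀) ≡ x →
      leftward 7 (cells ys) r (b ∷ []) ⟶[ cost (length ys) ] rightward (returning x) (cells ys) r []
    consult b ys r x e = within (≤-reflexive arith)
      (count ys (map sym vs ++ mark b₀ ∷ []) r (b ∷ [])
        ▷ sharpen vs (mark b₀) (map sym ys ʳ++ r) (trues (length ys) (b ∷ []))
        ▷ copy vs (mark b₀) (5 ∷ (map sym ys ʳ++ r)) (false ∷ trues (length ys) (b ∷ []))
        ▷ ask b₀ _ (vs ʳ++ false ∷ trues (length ys) (b ∷ [])) x
            (trans (cong O (asked-query b (length ys) vs b₀)) e)
        ▷ arriving (cong (λ l → rightward (returning x) l r []) back)
            (subst (λ r' → rightward (returning x) (mark b₀ ∷ []) r' [] ⟶[ length forth ]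
                rightward (returning x) (forth ʳ++ mark b₀ ∷ []) r []) split
              (return x (mark b₀ ∷ []) forth r
                (plain-ʳ++ (map-sym-plain vs) (sharp ∷ plain-ʳ++ (map-sym-plain ys) [])))))
      where
      forth : List ℕ
      forth = map sym vs ʳ++ 5 ∷ (map sym ys ʳ++ [])
      split : forth ++ r ≡ map sym vs ʳ++ 5 ∷ (map sym ys ʳ++ r)
      split = trans (≡.sym (ʳ++-++ (map sym vs) (5 ∷ (map sym ys ʳ++ [])) r))
        (cong (λ l → map sym vs ʳ++ 5 ∷ l) (≡.sym (ʳ++-++ (map sym ys) [] r)))
      back : forth ʳ++ mark b₀ ∷ [] ≡ cells ys
      back = trans (ʳ++-ʳ++ (map sym vs)) (ʳ++-ʳ++ (map sym ys))
      forth-length : length forth ≡ length vs + suc (length ys + 0)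
      forth-length = trans (length-ʳ++ (map sym vs) _) (cong₂ (λ m n → m + suc n) (length-map sym vs)
        (trans (length-ʳ++ (map sym ys) []) (cong (_+ 0) (length-map sym ys))))
      arith : length ys + (1 + (length vs + (3 + length forth))) ≡ cost (length ys)
      arith rewrite forth-length = solve 2 (λ y v → y :+ (con 1 :+ (v :+ (con 3 :+ (v :+ (con 1 :+ (y :+ con 0))))))
        := con 2 :* (y :+ v) :+ con 5) refl (length ys) (length vs)

    place : ∀ b l → rightward (returning b) l (6 ∷ []) [] ⟶[ 1 ] leftward 7 (sym b ∷ l) [] (true ∷ [])
    place false l = step λ _ → refl
    place true  l = step λ _ → refl

    prepare : ∀ ys → rightward 9 (cells ys) [] [] ⟶[ 1 ] leftward 7 (cells ys) (6 ∷ []) (false ∷ [])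
    prepare []       = step λ _ → refl
    prepare (_ ∷ ys) = step λ _ → refl

    leave : ∀ ys → rightward 10 (cells ys) [] [] ⟶[ 1 ] leftward 11 (cells ys) (0 ∷ []) []
    leave []       = step λ _ → refl
    leave (_ ∷ ys) = step λ _ → refl

    accept : ∀ l r → leftward 11 (5 ∷ l) r [] ⟶[ 1 ] rightward 1 (5 ∷ l) r []
    accept l []      = step λ _ → refl
    accept l (_ ∷ _) = step λ _ → refl

    takeBits-reverse : ∀ ys r → takeBits (map sym ys ʳ++ r) ≡ ys ʳ++ takeBits r
    takeBits-reverse []           r = refl
    takeBits-reverse (false ∷ ys) r = takeBits-reverse ys (1 ∷ r)
    takeBits-reverse (true ∷ ys)  r = takeBits-reverse ys (2 ∷ r)

    output-rightward : ∀ l r → output (rightward 1 l (r ++ 0 ∷ []) []) ≡ takeBits (r ++ 0 ∷ [])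
    output-rightward l []      = refl
    output-rightward l (_ ∷ r) = refl

    Halts : ℕ → Config → Word → Set
    Halts n c₁ y = ∃[ c₂ ] ∃[ l ] ∃[ r ] c₁ ⟶[ n ] c₂ × c₂ ≡ rightward 1 l r [] × output c₂ ≡ y

    finish : ∀ ys → Halts (3 + length ys) (rightward 10 (cells ys) [] []) (reverse ys)
    finish ys = _ , _ , _ ,
      within (s≤s (≤-trans (≤-reflexive (+-comm (length ys) 1)) (n≤1+n _)))
        (leave ys ▷ find ys _ (0 ∷ []) ▷ accept _ (map sym ys ʳ++ 0 ∷ [])) ,
      refl ,
      trans (cong (λ r → output (rightward 1 (5 ∷ map sym vs ++ mark b₀ ∷ []) r [])) (ʳ++-++ (map sym ys) [] (0 ∷ [])))
        (trans (output-rightward _ (map sym ys ʳ++ []))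
          (trans (cong takeBits (≡.sym (ʳ++-++ (map sym ys) [] (0 ∷ [])))) (takeBits-reverse ys (0 ∷ []))))

    then-halts : ∀ {m n c₁ c₂ y} → c₁ ⟶[ m ] c₂ → Halts n c₂ y → Halts (m + n) c₁ y
    then-halts r (c₂ , l , r' , h , e) = c₂ , l , r' , r ▷ h , e

    halts-within : ∀ {m n c₁ y} → m ≤ n → Halts m c₁ y → Halts n c₁ y
    halts-within p (c₂ , l , r , h , e) = c₂ , l , r , within p h , e

    module _ (z : Word) (told : ∀ b i → O (asked b i vs b₀) ≡ readBit b i z) where

      budget : ℕ
      budget = 4 * (length z + length vs) + 12

      round-budget : ∀ n → n ≤ length z → cost n + (1 + (cost n + 1)) ≤ budget
      round-budget n n≤ = ≤-trans
        (≤-reflexive (solve 2 (λ n v → (con 2 :* (n :+ v) :+ con 5) :+ (con 1 :+ ((con 2 :* (n :+ v) :+ con 5) :+ con 1))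
          := con 4 :* (n :+ v) :+ con 12) refl n (length vs)))
        (+-monoˡ-≤ 12 (*-monoʳ-≤ 4 (+-monoˡ-≤ (length vs) n≤)))

      last-budget : ∀ n → n ≤ length z → cost n + (3 + n) ≤ budget
      last-budget n n≤ = ≤-trans
        (≤-trans (m≤m+n _ (n + 2 * length vs + 4))
          (≤-reflexive (solve 2 (λ n v → ((con 2 :* (n :+ v) :+ con 5) :+ (con 3 :+ n)) :+ (n :+ con 2 :* v :+ con 4)
            := con 4 :* (n :+ v) :+ con 12) refl n (length vs))))
        (+-monoˡ-≤ 12 (*-monoʳ-≤ 4 (+-monoˡ-≤ (length vs) n≤)))

      known : ∀ b ys zs → z ≡ reverse ys ++ zs → O (asked b (length ys) vs b₀) ≡ readBit b ∣ reverse ys ∣ (reverse ys ++ zs)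
      known b ys zs e = trans (told b (length ys))
        (cong₂ (readBit b) (≡.sym (length-reverse ys)) e)

      prefix-length : ∀ ys zs → z ≡ reverse ys ++ zs → length ys ≤ length z
      prefix-length ys zs e = ≤-trans (≤-reflexive (≡.sym (length-reverse ys)))
        (≤-trans (m≤m+n _ (length zs)) (≤-reflexive (≡.sym (trans (cong length e) (length-++ (reverse ys))))))

      -- `ys` is the output found so far, backwards. Each further bit takes two consultations, for
      -- its existence and for its value; a last one finds that the output has ended.
      loop : ∀ ys zs → z ≡ reverse ys ++ zs →
        Halts (suc (length zs) * budget) (leftward 7 (cells ys) [] (true ∷ [])) z
      loop ys [] e = subst (Halts (1 * budget) (leftward 7 (cells ys) [] (true ∷ []))) (≡.sym (trans e (++-identityʳ _)))
        (halts-within (≤-trans (last-budget (length ys) (prefix-length ys [] e)) (m≤m+n budget 0))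
          (then-halts (consult true ys [] false (trans (known true ys [] e) (ended (reverse ys)))) (finish ys)))
        where
        ended : ∀ p → (∣ p ∣ <ᵇ ∣ p ++ [] ∣) ≡ false
        ended []      = refl
        ended (_ ∷ p) = ended p
      loop ys (b ∷ zs) e = halts-within
        (+-monoˡ-≤ (suc (length zs) * budget) (round-budget (length ys) (prefix-length ys (b ∷ zs) e)))
        (then-halts
          (consult true ys [] true (trans (known true ys (b ∷ zs) e) (more (reverse ys)))
            ▷ prepare ys
            ▷ consult false ys (6 ∷ []) b (trans (known false ys (b ∷ zs) e) (next (reverse ys)))
            ▷ place b (cells ys))
          (loop (b ∷ ys) zs (trans e (trans (≡.sym (++-assoc (reverse ys) (b ∷ []) zs))
            (cong (_++ zs) (≡.sym (unfold-reverse b ys)))))))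
        where
        more : ∀ p → (∣ p ∣ <ᵇ ∣ p ++ b ∷ zs ∣) ≡ true
        more []      = refl
        more (_ ∷ p) = more p
        next : ∀ p → bit ∣ p ∣ (p ++ b ∷ zs) ≡ b
        next []      = refl
        next (_ ∷ p) = next p

  -- On empty input the marked first cell is not a bit of the argument: it serves as the 0 that ends
  -- the unary number `c`. This is why the default is `false` and why `rest` has no separator in
  -- that case.
  startBit : Word → Bool
  startBit []      = false
  startBit (b ∷ _) = b

  rest : Word → Word
  rest []       = replicate c true
  rest (b ∷ bs) = replicate c true ++ false ∷ reverse bs

  rest-start : ∀ w → rest w ++ startBit w ∷ [] ≡ unary c (reverse w)
  rest-start [] = go c
    where
    go : ∀ n → replicate n true ++ false ∷ [] ≡ unary n []
    go zero    = refl
    go (suc n) = cong (true ∷_) (go n)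
  rest-start (b ∷ bs) = trans (++-assoc (replicate c true) (false ∷ reverse bs) (b ∷ []))
    (trans (cong (λ x → replicate c true ++ false ∷ x) (≡.sym (unfold-reverse b bs))) (go c))
    where
    go : ∀ n → replicate n true ++ false ∷ reverse (b ∷ bs) ≡ unary n (reverse (b ∷ bs))
    go zero    = refl
    go (suc n) = cong (true ∷_) (go n)

  rest-length : ∀ w → length (rest w) ≤ c + ∣ w ∣
  rest-length []       = ≤-trans (≤-reflexive (length-replicate c)) (m≤m+n c 0)
  rest-length (b ∷ bs) = ≤-reflexive (trans (length-++ (replicate c true))
    (cong₂ (λ m n → m + suc n) (length-replicate c) (length-reverse bs)))

  beginning : ∀ w → initConfig w ⟶[ ∣ w ∣ + (c + 3) ] leftward 7 (cells (rest w) (startBit w) []) [] (true ∷ [])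
  beginning [] = within (≤-trans (n≤1+n _) (≤-reflexive (+-comm 3 c)))
    (step {c' = config (12 + c) (3 ∷ []) 0 [] []} (λ _ → refl) ▷ counted c (3 ∷ []) ≤-refl)
  beginning (b ∷ bs) = within (s≤s (+-monoʳ-≤ (length bs) (≤-trans (n≤1+n _) (≤-reflexive (+-comm 3 c)))))
    (marking b bs ▷ scan bs (mark b ∷ [])
      ▷ step {c' = config (12 + c) (1 ∷ (map sym bs ʳ++ mark b ∷ [])) 0 [] []} (λ _ → refl)
        ▷ arriving (cong (λ l → config 7 l 5 [] (true ∷ [])) written) (counted c (1 ∷ (map sym bs ʳ++ mark b ∷ [])) ≤-refl))
    where
    marking : ∀ b bs → initConfig (b ∷ bs) ⟶[ 1 ] rightward 6 (mark b ∷ []) (map sym bs) []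
    marking false []      = step λ _ → refl
    marking false (_ ∷ _) = step λ _ → refl
    marking true  []      = step λ _ → refl
    marking true  (_ ∷ _) = step λ _ → refl
    written : map sym (replicate c true) ++ 1 ∷ (map sym bs ʳ++ mark b ∷ []) ≡ map sym (rest (b ∷ bs)) ++ mark b ∷ []
    written = ≡.sym (trans (cong (_++ mark b ∷ []) (map-++ sym (replicate c true) (false ∷ reverse bs)))
      (trans (++-assoc (map sym (replicate c true)) _ _)
        (cong (λ r → map sym (replicate c true) ++ 1 ∷ r)
          (trans (cong (_++ mark b ∷ []) (map-ʳ++ sym bs)) (≡.sym (ʳ++-++ (map sym bs) [] (mark b ∷ [])))))))

-- Polynomial time bounds

infixl 6 _+ᴾ_
infixl 7 _*ᴾ_

_+ᴾ_ : Poly → Poly → Poly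
[]      +ᴾ q        = q
(c ∷ p) +ᴾ []       = c ∷ p
(c ∷ p) +ᴾ (d ∷ q)  = c + d ∷ p +ᴾ q

_*ᴾ_ : Poly → Poly → Poly
[]      *ᴾ q = []
(c ∷ p) *ᴾ q = map (c *_) q +ᴾ (0 ∷ p *ᴾ q)

eval-+ : ∀ p q n → eval (p +ᴾ q) n ≡ eval p n + eval q n
eval-+ []      q       n = refl
eval-+ (c ∷ p) []      n = ≡.sym (+-identityʳ _)
eval-+ (c ∷ p) (d ∷ q) n rewrite eval-+ p q n =
  solve 5 (λ c d n x y → (c :+ d) :+ n :* (x :+ y) := (c :+ n :* x) :+ (d :+ n :* y)) refl c d n (eval p n) (eval q n)

eval-scale : ∀ c q n → eval (map (c *_) q) n ≡ c * eval q n
eval-scale c []      n = ≡.sym (*-zeroʳ c)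
eval-scale c (d ∷ q) n rewrite eval-scale c q n =
  solve 4 (λ c d n x → c :* d :+ n :* (c :* x) := c :* (d :+ n :* x)) refl c d n (eval q n)

eval-* : ∀ p q n → eval (p *ᴾ q) n ≡ eval p n * eval q n
eval-* []      q n = refl
eval-* (c ∷ p) q n rewrite eval-+ (map (c *_) q) (0 ∷ p *ᴾ q) n | eval-scale c q n | eval-* p q n =
  solve 4 (λ c n x y → c :* y :+ n :* (x :* y) := (c :+ n :* x) :* y) refl c n (eval p n) (eval q n)

record Polynomial (F : ℕ → ℕ) : Set where
  constructor polynomial
  field
    poly  : Poly
    evals : ∀ n → eval poly n ≡ F n
open Polynomial

infixl 6 _⊕_
infixl 7 _⊗_

_⊕_ : ∀ {F G} → Polynomial F → Polynomial G → Polynomial (λ n → F n + G n)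
polynomial p e ⊕ polynomial q e' = polynomial (p +ᴾ q) λ n → trans (eval-+ p q n) (cong₂ _+_ (e n) (e' n))

_⊗_ : ∀ {F G} → Polynomial F → Polynomial G → Polynomial (λ n → F n * G n)
polynomial p e ⊗ polynomial q e' = polynomial (p *ᴾ q) λ n → trans (eval-* p q n) (cong₂ _*_ (e n) (e' n))

constant : ∀ k → Polynomial (λ _ → k)
constant k = polynomial (k ∷ []) λ n → trans (cong (k +_) (*-zeroʳ n)) (+-identityʳ k)

identity : Polynomial (λ n → n)
identity = polynomial (0 ∷ 1 ∷ []) λ n → trans (cong (λ x → n * (1 + x)) (*-zeroʳ n)) (*-identityʳ n)

readerTime : ∀ c r → Polynomial (λ n → n + (c + 3) + (1 + eval r n) * (4 * (eval r n + (c + n)) + 12))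
readerTime c r = identity ⊕ constant (c + 3) ⊕
  (constant 1 ⊕ given) ⊗ (constant 4 ⊗ (given ⊕ (constant c ⊕ identity)) ⊕ constant 12)
  where
  given : Polynomial (eval r)
  given = polynomial r λ _ → refl

-- The only construction of polynomial-time functions in the proof: whatever the oracle stores with
-- values of polynomial length is computed by `reader`, with one `budget` for each output bit and
-- one for the end.
reader-FP : ∀ O c h r → (∀ w → ∣ h w ∣ ≤ eval r ∣ w ∣) →
  (∀ w b i → O (b ∷ unary i (unary c (reverse w))) ≡ readBit b i (h w)) → FP O h
reader-FP O c h r short told = reader c , poly (readerTime c r) , computes
  where
  open Reader O c
  computes : ComputesIn O (reader c) (poly (readerTime c r)) h
  computes w with then-halts (rest w) (startBit w) (beginning w)
    (loop (rest w) (startBit w) (h w)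
      (λ b i → trans (cong (λ v → O (b ∷ unary i v)) (rest-start w)) (told w b i)) [] (h w) refl)
  ... | c₂ , l , r' , reach t t≤ runs , refl , out = c₂ , runD-mono O M {t + 0} (initConfig w) bound (trans (runs 0) (accepted r')) , out
    where
    accepted : ∀ r → runD O M 0 (rightward 1 l r []) ≡ just (rightward 1 l r [])
    accepted []      = refl
    accepted (_ ∷ _) = refl
    bound : t + 0 ≤ eval (poly (readerTime c r)) ∣ w ∣
    bound = ≤-trans (≤-reflexive (+-identityʳ t)) (≤-trans t≤ (≤-trans
      (+-monoʳ-≤ (∣ w ∣ + (c + 3)) (*-mono-≤ (s≤s (short w))
        (+-monoˡ-≤ 12 (*-monoʳ-≤ 4 (+-mono-≤ (short w) (rest-length w))))))
      (≤-reflexive (≡.sym (evals (readerTime c r) ∣ w ∣)))))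

-- Guessing machines

module _ (O : Oracle) (b : Bool) where

  children : List ℕ → List ℕ → List Bool → List Config
  children l r q = rightward 8 (1 ∷ l) r (false ∷ q) ∷ rightward 8 (1 ∷ l) r (true ∷ q) ∷ []

  branching : ∀ l r q → succs O (guesser b) (config 8 l 1 r q) ≡ children l r q
  branching l []      q = refl
  branching l (_ ∷ _) q = refl

  guessing-sound : ∀ t n l q → accWithin O (guesser b) t (rightward 8 l (replicate n 1) q) ≡ true →
    ∃[ z ] ∣ z ∣ ≡ n × O (reverse (z ʳ++ q)) ≡ true
  guessing-sound zero          zero    l q ()
  guessing-sound (suc zero)    zero    l q ()
  guessing-sound (suc (suc t)) zero    l q e with O (reverse q) in o
  ... | true  = [] , refl , o
  guessing-sound (suc (suc zero))    zero l q () | false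
  guessing-sound (suc (suc (suc t))) zero l q () | false
  guessing-sound zero          (suc n) l q ()
  guessing-sound (suc t)       (suc n) l q e
    with ∈-any (accWithin O (guesser b) t) (children l (replicate n 1) q) (trans (cong (any (accWithin O (guesser b) t)) (≡.sym (branching l (replicate n 1) q))) e)
  ... | _ , here refl , e' with guessing-sound t n (1 ∷ l) (false ∷ q) e'
  ... | z , len , o = false ∷ z , cong suc len , o
  guessing-sound (suc t)       (suc n) l q e | _ , there (here refl) , e' with guessing-sound t n (1 ∷ l) (true ∷ q) e'
  ... | z , len , o = true ∷ z , cong suc len , o
  guessing-sound (suc t)       (suc n) l q e | _ , there (there ()) , e'

  guessing-complete : ∀ z l q → O (reverse (z ʳ++ q)) ≡ true →
    accWithin O (guesser b) (3 + ∣ z ∣) (rightward 8 l (replicate ∣ z ∣ 1) q) ≡ true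
  guessing-complete []      l q o rewrite o = refl
  guessing-complete (c ∷ z) l q o = trans
    (cong (any (accWithin O (guesser b) (3 + ∣ z ∣))) (branching l (replicate ∣ z ∣ 1) q))
    (any-∈ (accWithin O (guesser b) (3 + ∣ z ∣)) (children l (replicate ∣ z ∣ 1) q) (child c) (guessing-complete z (1 ∷ l) (c ∷ q) o))
    where
    child : ∀ c → rightward 8 (1 ∷ l) (replicate ∣ z ∣ 1) (c ∷ q) ∈ children l (replicate ∣ z ∣ 1) q
    child false = here refl
    child true  = there (here refl)

  guessed : ∀ z → reverse (z ʳ++ false ∷ false ∷ b ∷ []) ≡ witness b z
  guessed z = trans (ʳ++-ʳ++ z) (cong (witness b) (++-identityʳ z))

  guesser-start : ℕ → Config
  guesser-start m = initConfig (0^ (suc m))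

  guesser-start-≡ : ∀ m → guesser-start m ≡ config 0 [] 1 (replicate m 1) []
  guesser-start-≡ m = cong (λ r → config 0 [] 1 r []) (map-replicate sym m false)

  only : ∀ {A : Set} (p : A → Bool) x → any p (x ∷ []) ≡ true → p x ≡ true
  only p x e = trans (≡.sym (∨-identityʳ (p x))) e

  guesser-sound : ∀ t m → accWithin O (guesser b) t (guesser-start m) ≡ true →
    ∃[ z ] ∣ z ∣ ≡ suc m × O (witness b z) ≡ true
  guesser-sound t m e = go t (trans (cong (accWithin O (guesser b) t) (≡.sym (guesser-start-≡ m))) e)
    where
    go : ∀ t → accWithin O (guesser b) t (config 0 [] 1 (replicate m 1) []) ≡ true →
      ∃[ z ] ∣ z ∣ ≡ suc m × O (witness b z) ≡ true
    go (suc (suc (suc t))) e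
      with guessing-sound t (suc m) [] (false ∷ false ∷ b ∷ [])
        (only (accWithin O (guesser b) t) _ (only (accWithin O (guesser b) (suc t)) (config 7 [] 1 (replicate m 1) (false ∷ b ∷ []))
          (only (accWithin O (guesser b) (suc (suc t))) (config 6 [] 1 (replicate m 1) (b ∷ [])) e)))
    ... | z , len , o = z , len , trans (cong O (≡.sym (guessed z))) o

  guesser-complete : ∀ z m → ∣ z ∣ ≡ suc m → O (witness b z) ≡ true →
    accWithin O (guesser b) (suc m + 6) (guesser-start m) ≡ true
  guesser-complete z m len o = subst (λ k → accWithin O (guesser b) k (guesser-start m) ≡ true) (+-comm 6 (suc m))
    (trans (cong (accWithin O (guesser b) (6 + suc m)) (guesser-start-≡ m))
      (trans (∨-identityʳ _) (trans (∨-identityʳ _) (trans (∨-identityʳ _)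
        (subst (λ n → accWithin O (guesser b) (3 + n) (rightward 8 [] (replicate n 1) (false ∷ false ∷ b ∷ [])) ≡ true) len
          (guessing-complete z [] (false ∷ false ∷ b ∷ []) (trans (cong O (guessed z)) o)))))))

  clock : ℕ → ℕ → ℕ
  clock m p = p ⊓ pᵢ (guesserIndex b) ∣ 0^ (suc m) ∣

  guess-sound : ∀ m p → InLp O (guesserIndex b) p (0^ (suc m)) → ∃[ z ] ∣ z ∣ ≡ suc m × O (witness b z) ≡ true
  guess-sound m p e = guesser-sound (clock m p) m (subst (λ M → accWithin O M (clock m p) (guesser-start m) ≡ true) (N-guesserIndex b) e)

  guess-complete : ∀ z m → ∣ z ∣ ≡ suc m → O (witness b z) ≡ true →
    InLp O (guesserIndex b) (suc m + 6) (0^ (suc m))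
  guess-complete z m len o = subst (λ M → accWithin O M (clock m (suc m + 6)) (guesser-start m) ≡ true) (≡.sym (N-guesserIndex b))
    (accWithin-mono O (guesser b) {suc m + 6} (guesser-start m) bound (guesser-complete z m len o))
    where
    power : ∀ i → 1 ≤ i → suc m ≤ suc m ^ i
    power (suc i) _ = ≤-trans (≤-reflexive (≡.sym (*-identityʳ (suc m)))) (*-monoʳ-≤ (suc m) (m^n>0 (suc m) i))
    -- The clock is `suc m ^ i + i` for the index `i` of the guesser. The power covers `suc m` since
    -- `i` is positive, and the summand covers 6 since an index exceeds the number of rules.
    bound : suc m + 6 ≤ clock m (suc m + 6)
    bound rewrite 0^-length m = ⊓-glb ≤-refl
      (+-mono-≤ (power (guesserIndex b) (≤-trans (s≤s z≤n) (guesserIndex-large b))) (guesserIndex-large b))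

-- The p-optimal proof system for the complement of C

witnessLen-suc : ∀ s → witnessLen s ≡ suc (tower s + 4)
witnessLen-suc s = +-suc (tower s) 4

Witnessed : Oracle → Bool → ℕ → Set
Witnessed O b s = ∃[ z ] ∣ z ∣ ≡ witnessLen s × O (witness b z) ≡ true

accepts-witnessed : ∀ O b s p → InLp O (guesserIndex b) p (0^ (witnessLen s)) → Witnessed O b s
accepts-witnessed O b s p = subst
  (λ m → InLp O (guesserIndex b) p (0^ m) → ∃[ z ] ∣ z ∣ ≡ m × O (witness b z) ≡ true)
  (≡.sym (witnessLen-suc s)) (guess-sound O b (tower s + 4) p)

witnessed-accepts : ∀ O b s → Witnessed O b s → InLp O (guesserIndex b) (witnessLen s + 6) (0^ (witnessLen s))
witnessed-accepts O b s (z , len , o) = subst (λ m → ∣ z ∣ ≡ m → InLp O (guesserIndex b) (m + 6) (0^ m))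
  (≡.sym (witnessLen-suc s)) (λ len → guess-complete O b z (tower s + 4) len o) len

0^-injective : ∀ {m n} → 0^ m ≡ 0^ n → m ≡ n
0^-injective {m} {n} e = trans (≡.sym (0^-length m)) (trans (cong length e) (0^-length n))

hard-intro : ∀ O s → Witnessed O false s → ¬ Witnessed O true s → D O (hard s)
hard-intro O s w ¬w = guesserIndex false , guesserIndex true , 0^ (witnessLen s) , witnessLen s + 6 , refl ,
  witnessed-accepts O false s w , λ acc → ¬w (accepts-witnessed O true s (witnessLen s + 6) acc)

hard-elim : ∀ O s → D O (hard s) → Witnessed O false s × ¬ Witnessed O true s
hard-elim O s (i , j , x , p , e , acc , rej) = go (same e) acc rej
  where
  Same : Set
  Same = (guesserIndex false ≡ i) × (guesserIndex true ≡ j) × (0^ (witnessLen s) ≡ x) × (witnessLen s + 6 ≡ p)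
  split : 0^ (guesserIndex false) ∷ 0^ (guesserIndex true) ∷ 0^ (witnessLen s) ∷ 0^ (witnessLen s + 6) ∷ []
    ≡ 0^ i ∷ 0^ j ∷ x ∷ 0^ p ∷ [] → Same
  split e with ∷-injective e
  ... | e₁ , r₁ with ∷-injective r₁
  ... | e₂ , r₂ with ∷-injective r₂
  ... | e₃ , r₃ with ∷-injective r₃
  ... | e₄ , _ = 0^-injective e₁ , 0^-injective e₂ , e₃ , 0^-injective e₄
  same : hard s ≡ ⟨ 0^ i ∷ 0^ j ∷ x ∷ 0^ p ∷ [] ⟩ → Same
  same e = split (trans
    (≡.sym (untuple-⟨⟩ (0^ (guesserIndex false) ∷ 0^ (guesserIndex true) ∷ 0^ (witnessLen s) ∷ 0^ (witnessLen s + 6) ∷ [])))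
    (trans (cong untuple e) (untuple-⟨⟩ (0^ i ∷ 0^ j ∷ x ∷ 0^ p ∷ []))))
  go : Same → InLp O i p x → ¬ InLp O j p x → Witnessed O false s × ¬ Witnessed O true s
  go (refl , refl , refl , refl) acc rej =
    accepts-witnessed O false s (witnessLen s + 6) acc , λ w → rej (witnessed-accepts O true s w)

Refuted : ℕ → Set
Refuted s = D 𝒪 (hard s) × (∃[ u ] transduce 𝒪 (target s) (horizon s) u ≡ just (hard s))

𝒪-chosen : ∀ s {ws} → chosen s ≡ ws → Below (stageLen (suc s)) 𝒪 (Stage.oracle s (history s) ws)
𝒪-chosen s refl = 𝒪-stage s

chosen-witness : ∀ s b {z ws} → ∣ z ∣ ≡ witnessLen s → chosen s ≡ ws → 𝒪 (witness b z) ≡ (witness b z ∈ᵇ ws)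
chosen-witness s b {z} len refl = 𝒪-witness s b z len

∈⇒∈ᵇ : ∀ v ws → v ∈ ws → (v ∈ᵇ ws) ≡ true
∈⇒∈ᵇ v ws i = any-∈ (λ u → ⌊ v ≟ʷ u ⌋) ws i (≟ʷ-refl v)

refuted-stage : ∀ s z₀ u → ∣ z₀ ∣ ≡ witnessLen s → chosen s ≡ witness false z₀ ∷ [] →
  transduce (Stage.oracle s (history s) (witness false z₀ ∷ [])) (target s) (horizon s) u ≡ just (hard s) → Refuted s
refuted-stage s z₀ u len₀ e t =
  hard-intro 𝒪 s (z₀ , len₀ , trans (chosen-witness s false len₀ e) (∈⇒∈ᵇ (witness false z₀) (witness false z₀ ∷ []) (here refl)))
    (λ (z , len , w) → true≢false (trans (≡.sym (chosen-witness s true len e)) w) refl) ,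
  u , trans (transduce-local (target s) (horizon s) u (𝒪-chosen s e)) t

-- In all other outcomes there is either no witness tagged `false` or one tagged `true`.
hard-verdict : ∀ s → ¬ D 𝒪 (hard s) ⊎ Refuted s
hard-verdict s = go (outcome s (history s)) refl
  where
  unwitnessed : chosen s ≡ [] → ¬ D 𝒪 (hard s)
  unwitnessed e d with hard-elim 𝒪 s d
  ... | (z , len , w) , _ = true≢false (trans (≡.sym (chosen-witness s false len e)) w) refl
  go : ∀ {ws} → Outcome s (history s) ws → chosen s ≡ ws → ¬ D 𝒪 (hard s) ⊎ Refuted s
  go (kills j (inj₁ refl) _ _ _) e = inj₁ (unwitnessed e)
  go (kills j (inj₂ (z₀ , z₁ , len₀ , len₁ , refl)) _ _ _) e = inj₁ λ d → proj₂ (hard-elim 𝒪 s d)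
    (z₁ , len₁ , trans (chosen-witness s true len₁ e) (∈⇒∈ᵇ (witness true z₁) (pairing z₀ z₁) (there (here refl))))
  go (refuted z₀ u len₀ t) e = inj₂ (refuted-stage s z₀ u len₀ e t)
  go (waits _) e = inj₁ (unwitnessed e)

[]∉⟨⟩ : ∀ u us → [] ≢ ⟨ u ∷ us ⟩
[]∉⟨⟩ u us e with () ← subst (∣ u ∣ <_) (cong length (≡.sym e)) (∈-⟨⟩-length {us = u ∷ us} (here refl))

[]∉C : ∀ O → ¬ C O []
[]∉C O (i , x , p , e , _) = []∉⟨⟩ (0^ i) (x ∷ 0^ p ∷ []) e

[]∉D : ∀ O → ¬ D O []
[]∉D O (i , j , x , p , e , _) = []∉⟨⟩ (0^ i) (0^ j ∷ x ∷ 0^ p ∷ []) e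

padded-sound : ∀ {A : Oracle → Word → Set} (Aᵇ : Oracle → Word → Bool) O →
  (∀ y → A O y → Aᵇ O y ≡ true) → ¬ A O [] → ∀ t x → ¬ A O (padded Aᵇ O t x)
padded-sound Aᵇ O complete ¬[] t x with stageLen ∣ x ∣ ≤ᵇ t
... | false = ¬[]
... | true with Aᵇ O x in e
... | true  = ¬[]
... | false = λ a → true≢false (complete x a) e

padded-complete : ∀ Aᵇ O y → Aᵇ O y ≡ false → padded Aᵇ O (stageLen ∣ y ∣) y ≡ y
padded-complete Aᵇ O y e rewrite true-≤ᵇ (≤-refl {stageLen ∣ y ∣}) | e = refl

padded-length : ∀ Aᵇ O t x → ∣ padded Aᵇ O t x ∣ ≤ ∣ x ∣
padded-length Aᵇ O t x with (stageLen ∣ x ∣ ≤ᵇ t) ∧ not (Aᵇ O x)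
... | true  = ≤-refl
... | false = z≤n

ParseBound : Word → ℕ × ℕ × Word → Set
ParseBound w p = proj₁ p + (proj₁ (proj₂ p) + ∣ proj₂ (proj₂ p) ∣) ≤ ∣ w ∣

hf-length : ∀ O w → ∣ hf O w ∣ ≤ ∣ w ∣
hf-length O w = go (parse w) (parse-length {w} refl)
  where
  go : ∀ p → ParseBound w p → ∣ (hf₃ O ∣ w ∣ p) ∣ ≤ ∣ w ∣
  go (zero  , t , x) len = ≤-trans (padded-length inC O t x) (≤-trans (m≤n+m _ t) len)
  go (suc j , t , x) len with admitted j ∣ w ∣ ∧ not (dead O j ∣ w ∣)
  ... | false = z≤n
  ... | true with transduce O j t x in e
  ... | nothing = z≤n
  ... | just y  = ≤-trans (transduce-length O j t x e) (≤-trans (s≤s (m≤n+m _ j)) len)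

-- A code is among the codes that can catch its own transducer: were the value in C, `w` itself
-- would withdraw the trust at length `∣ w ∣`.
hf-sound : ∀ O w → ¬ C O (hf O w)
hf-sound O w = go (parse w) refl
  where
  go : ∀ p → parse w ≡ p → ¬ C O (hf₃ O ∣ w ∣ p)
  go (zero  , t , x) e = padded-sound {C} inC O (inC-complete O) ([]∉C O) t x
  go (suc j , t , x) e with admitted j ∣ w ∣
  ... | false = []∉C O
  ... | true with dead O j ∣ w ∣ in d
  ... | true  = []∉C O
  ... | false with transduce O j t x in r
  ... | nothing = []∉C O
  ... | just y  = λ c → true≢false (dead-intro O j w ≤-refl (violation c)) d
    where
    violation : C O y → violates O j w ≡ true
    violation c = trans (cong (violates₃ O j) e) (both (≡ᵇ-refl j) (trans (cong (errs O) r) (inC-complete O y c)))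
      where
      both : ∀ {a b} → a ≡ true → b ≡ true → a ∧ b ≡ true
      both refl refl = refl
      ≡ᵇ-refl : ∀ n → (n ≡ᵇ n) ≡ true
      ≡ᵇ-refl zero    = refl
      ≡ᵇ-refl (suc n) = ≡ᵇ-refl n

hf-complete : ∀ O y → ¬ C O y → ∃[ x ] hf O x ≡ y
hf-complete O y ¬c = w , trans (cong (hf₃ O ∣ w ∣) (parse-unary 0 (stageLen ∣ y ∣) y))
    (padded-complete inC O y (not-in (inC O y) refl))
  where
  w : Word
  w = unary 0 (unary (stageLen ∣ y ∣) y)
  not-in : ∀ b → inC O y ≡ b → inC O y ≡ false
  not-in true  e = ⊥-elim (¬c (inC-sound O y e))
  not-in false e = e

stored-FP : ∀ e {F} → (P : Polynomial F) → (∀ w → ∣ stored 𝒪 e w ∣ ≤ F ∣ w ∣) → FP 𝒪 (stored 𝒪 e)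
stored-FP e P short = reader-FP 𝒪 (suc e) (stored 𝒪 e) (poly P)
  (λ w → ≤-trans (short w) (≤-reflexive (≡.sym (evals P ∣ w ∣)))) (λ w b i → 𝒪-stored e w b i)

FP-cong : ∀ {O f g} → (∀ w → f w ≡ g w) → FP O f → FP O g
FP-cong e (M , q , comp) = M , q , λ x → proj₁ (comp x) , proj₁ (proj₂ (comp x)) , trans (proj₂ (proj₂ (comp x))) (e x)

hf-proofSystem : ProofSystem 𝒪 (co (C 𝒪)) (hf 𝒪)
hf-proofSystem = stored-FP 0 identity (hf-length 𝒪) ,
  λ y → hf-complete 𝒪 y , λ { (x , refl) → hf-sound 𝒪 x }

computes-transduce : ∀ {O M f} q → ComputesIn O M q f → ∀ j → N j ≡ M → ∀ {t} x → eval q ∣ x ∣ ≤ t →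
  transduce O j t x ≡ just (f x)
computes-transduce {O} {M} q comp j refl x p with comp x
... | c , r , out = trans (transduce-just O j _ x (runD-mono O M (initConfig x) p r)) (cong just out)

transduce-computes : ∀ {O M f} q → ComputesIn O M q f → ∀ j → N j ≡ M → ∀ t x {y} →
  transduce O j t x ≡ just y → f x ≡ y
transduce-computes {O} {M} q comp j refl t x e with comp x | just-transduce O j t x e
... | c , r , out | c' , r' , out' =
  trans (≡.sym out) (trans (cong output (runD-unique O M (eval q ∣ x ∣) t (initConfig x) r r')) out')

abstract
  storedPad : ∀ js → ∃[ e ] (∀ O w → stored O e w ≡ pad js w)
  storedPad js = suc (pair 1 (encodeList js)) , λ O w →
    trans (cong (λ p → stored₂ O p w) (unpair-pair 1 (encodeList js))) (cong (λ l → pad l w) (decodeList-encodeList js))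

  storedG : ∀ k → ∃[ e ] (∀ O w → stored O e w ≡ hg O k w)
  storedG k = suc (pair 0 k) , λ O w → cong (λ p → stored₂ O p w) (unpair-pair 0 k)

hf-pSimulates : ∀ g → ProofSystem 𝒪 (co (C 𝒪)) g → PSimulates 𝒪 (hf 𝒪) g
hf-pSimulates g ((M , q , comp) , image) with indexed M
... | j , Nj , _ with diagonal-start (suc j)
... | s , us = π , FP-cong (λ w → proj₂ (storedPad (j ∷ poly time)) 𝒪 w)
    (stored-FP (proj₁ (storedPad (j ∷ poly time))) size
      (λ w → ≤-reflexive (trans (cong length (proj₂ (storedPad (j ∷ poly time)) 𝒪 w)) (π-length w)))) ,
    poly size , λ x → ≤-reflexive (trans (π-length x) (≡.sym (evals size ∣ x ∣))) , simulated x
  where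
  time : Polynomial (λ n → eval q n + stageLen s)
  time = polynomial q (λ _ → refl) ⊕ constant (stageLen s)
  π : Word → Word
  π = pad (j ∷ poly time)
  size : Polynomial (λ n → suc j + (1 + (eval (poly time) n + (1 + n))))
  size = constant (suc j) ⊕ (constant 1 ⊕ (polynomial (poly time) (λ _ → refl) ⊕ (constant 1 ⊕ identity)))
  π-length : ∀ x → ∣ π x ∣ ≡ suc j + (1 + (eval (poly time) ∣ x ∣ + (1 + ∣ x ∣)))
  π-length x = trans (unary-length (suc j) (unary (eval (poly time) ∣ x ∣) x))
    (cong (λ k → suc j + suc k) (unary-length (eval (poly time) ∣ x ∣) x))
  long : ∀ x → stageLen s ≤ ∣ π x ∣
  long x = ≤-trans (≤-trans (m≤n+m _ (eval q ∣ x ∣)) (≤-reflexive (≡.sym (evals time ∣ x ∣))))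
    (≤-trans (≤-trans (m≤m+n _ (1 + ∣ x ∣)) (≤-trans (n≤1+n _) (m≤n+m _ (suc j)))) (≤-reflexive (≡.sym (π-length x))))
  admits : ∀ x → admitted j ∣ π x ∣ ≡ true
  admits x = admitted-intro s j ∣ π x ∣ (≤-trans (<⇒≤ (s<stageLen s)) (long x)) (long x)
    (≤-reflexive (≡.sym (trans (cong (λ p → proj₁ p + proj₂ p) us) (+-identityʳ (suc j)))))
  -- A violation would be a value of `g` in C, whatever time bound the code states, because halting
  -- runs of one machine on one input agree.
  alive : ∀ ℓ b → dead 𝒪 j ℓ ≡ b → dead 𝒪 j ℓ ≡ false
  alive ℓ false d = d
  alive ℓ true d with dead-elim 𝒪 j ℓ d
  ... | w , _ , v = ⊥-elim (impossible (parse w) v)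
    where
    impossible : ∀ p → violates₃ 𝒪 j p ≡ true → ⊥
    impossible (a , t , x) v with ∧-true {a ≡ᵇ suc j} v
    ... | _ , v' with transduce 𝒪 j t x in r
    ... | just y = proj₂ (image y) (x , transduce-computes q comp j Nj t x r) (inC-sound 𝒪 y v')
  simulated : ∀ x → hf 𝒪 (π x) ≡ g x
  simulated x = trans (cong (hf₃ 𝒪 ∣ π x ∣) (parse-unary (suc j) (eval (poly time) ∣ x ∣) x)) (trans
    (cong₂ (λ a d → if a ∧ not d then fromMaybe [] (transduce 𝒪 j (eval (poly time) ∣ x ∣) x) else [])
      (admits x) (alive ∣ π x ∣ _ refl))
    (cong (fromMaybe []) (computes-transduce q comp j Nj x
      (≤-trans (m≤m+n _ (stageLen s)) (≤-reflexive (≡.sym (evals time ∣ x ∣)))))))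

-- No optimal proof system for the complement of D

hardSize : ℕ → ℕ
hardSize m = 2 * guesserIndex false + 2 + (2 * guesserIndex true + 2 + (2 * m + 2 + (2 * (m + 6) + 2)))

hard-length : ∀ s → ∣ hard s ∣ ≡ hardSize (witnessLen s)
hard-length s =
  trans (part (guesserIndex false) (0^ (guesserIndex true) ∷ 0^ (witnessLen s) ∷ 0^ (witnessLen s + 6) ∷ [])) (cong (2 * guesserIndex false + 2 +_)
  (trans (part (guesserIndex true) (0^ (witnessLen s) ∷ 0^ (witnessLen s + 6) ∷ [])) (cong (2 * guesserIndex true + 2 +_)
  (trans (part (witnessLen s) (0^ (witnessLen s + 6) ∷ [])) (cong (2 * witnessLen s + 2 +_)
  (trans (part (witnessLen s + 6) []) (+-identityʳ _)))))))
  where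
  part : ∀ n us → ∣ ⟨ 0^ n ∷ us ⟩ ∣ ≡ 2 * n + 2 + ∣ ⟨ us ⟩ ∣
  part n us = trans (⟨⟩-length (0^ n) us) (cong (λ k → 2 * k + 2 + ∣ ⟨ us ⟩ ∣) (0^-length n))

hardSize-mono : ∀ {m n} → m ≤ n → hardSize m ≤ hardSize n
hardSize-mono p = +-monoʳ-≤ (2 * guesserIndex false + 2) (+-monoʳ-≤ (2 * guesserIndex true + 2)
  (+-mono-≤ (+-monoˡ-≤ 2 (*-monoʳ-≤ 2 p)) (+-monoˡ-≤ 2 (*-monoʳ-≤ 2 (+-monoˡ-≤ 6 p)))))

n≤hardSize : ∀ n → n ≤ hardSize n
n≤hardSize n = ≤-trans (m≤m+n n (n + 0)) (≤-trans (m≤m+n (2 * n) 2) (≤-trans (m≤m+n (2 * n + 2) _)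
  (≤-trans (m≤n+m _ (2 * guesserIndex true + 2)) (m≤n+m _ (2 * guesserIndex false + 2)))))

hardSize-polynomial : Polynomial hardSize
hardSize-polynomial = constant (2 * guesserIndex false + 2) ⊕ (constant (2 * guesserIndex true + 2)
  ⊕ (constant 2 ⊗ identity ⊕ constant 2 ⊕ (constant 2 ⊗ (identity ⊕ constant 6) ⊕ constant 2)))

hg-length : ∀ O k w → ∣ hg O k w ∣ ≤ hardSize ∣ w ∣
hg-length O k w = go (parse w) (parse-length {w} refl)
  where
  go : ∀ p → ParseBound w p → ∣ hg₃ O k p ∣ ≤ hardSize ∣ w ∣
  go (zero  , t , x) len = ≤-trans (padded-length inD O t x)
    (≤-trans (≤-trans (m≤n+m _ t) len) (n≤hardSize ∣ w ∣))
  go (suc s , t , x) len with target s ≡ᵇ k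
  ... | false = z≤n
  ... | true with witnessLen s ≤ᵇ t in e
  ... | false = z≤n
  ... | true  = ≤-trans (≤-reflexive (hard-length s)) (hardSize-mono {witnessLen s}
    (≤-trans (≤ᵇ-true {witnessLen s} e) (≤-trans (m≤m+n t _) (≤-trans (m≤n+m _ (suc s)) len))))

hg-sound : ∀ k → (∀ s → target s ≡ k → ¬ Refuted s) → ∀ w → ¬ D 𝒪 (hg 𝒪 k w)
hg-sound k safe w = go (parse w)
  where
  go : ∀ p → ¬ D 𝒪 (hg₃ 𝒪 k p)
  go (zero  , t , x) = padded-sound {D} inD 𝒪 (inD-complete 𝒪) ([]∉D 𝒪) t x
  go (suc s , t , x) with target s ≡ᵇ k in e
  ... | false = []∉D 𝒪
  ... | true with witnessLen s ≤ᵇ t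
  ... | false = []∉D 𝒪
  ... | true with hard-verdict s
  ... | inj₁ ¬d = ¬d
  ... | inj₂ r  = ⊥-elim (safe s (≡ᵇ-true (target s) k e) r)

hg-complete : ∀ O k y → ¬ D O y → ∃[ x ] hg O k x ≡ y
hg-complete O k y ¬d = unary 0 (unary (stageLen ∣ y ∣) y) ,
  trans (cong (hg₃ O k) (parse-unary 0 (stageLen ∣ y ∣) y)) (padded-complete inD O y (not-in (inD O y) refl))
  where
  not-in : ∀ b → inD O y ≡ b → inD O y ≡ false
  not-in true  e = ⊥-elim (¬d (inD-sound O y e))
  not-in false e = e

hg-proofSystem : ∀ k → (∀ s → target s ≡ k → ¬ Refuted s) → ProofSystem 𝒪 (co (D 𝒪)) (hg 𝒪 k)
hg-proofSystem k safe =
  FP-cong (λ w → proj₂ (storedG k) 𝒪 w) (stored-FP (proj₁ (storedG k)) hardSize-polynomial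
    (λ w → ≤-trans (≤-reflexive (cong length (proj₂ (storedG k) 𝒪 w))) (hg-length 𝒪 k w))) ,
  λ y → hg-complete 𝒪 k y , λ { (x , refl) → hg-sound k safe x }

shortProof : ℕ → Word
shortProof s = unary (suc s) (unary (witnessLen s) [])

hg-shortProof : ∀ O s → hg O (target s) (shortProof s) ≡ hard s
hg-shortProof O s = trans (cong (hg₃ O (target s)) (parse-unary (suc s) (witnessLen s) []))
  (cong₂ (λ a b → if a ∧ b then hard s else []) (≡ᵇ-refl (target s)) (true-≤ᵇ (≤-refl {witnessLen s})))
  where
  ≡ᵇ-refl : ∀ n → (n ≡ᵇ n) ≡ true
  ≡ᵇ-refl zero    = refl
  ≡ᵇ-refl (suc n) = ≡ᵇ-refl n

-- Polynomials against the tower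

eval-mono : ∀ p {m n} → m ≤ n → eval p m ≤ eval p n
eval-mono []      q = z≤n
eval-mono (c ∷ p) q = +-monoʳ-≤ c (*-mono-≤ q (eval-mono p q))

compose : ∀ q {F} → Polynomial F → Polynomial (λ n → eval q (F n))
compose []      P = constant 0
compose (c ∷ q) P = constant c ⊕ P ⊗ compose q P

-- Each coefficient costs two factors `n`: one for the Horner step, and one, being at least 2, to
-- absorb the sum of two terms of equal bound.
eval≤power : ∀ p n → 2 ≤ n → sum p ≤ n → eval p n ≤ n ^ (2 * length p)
eval≤power []      n 2≤n s≤n = z≤n
eval≤power (c ∷ p) n 2≤n s≤n = begin
  c + n * eval p n                 ≤⟨ +-mono-≤ c≤ (*-monoʳ-≤ n (eval≤power p n 2≤n (≤-trans (m≤n+m _ c) s≤n))) ⟩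
  n * n ^ k + n * n ^ k            ≡⟨ cong (n * n ^ k +_) (≡.sym (+-identityʳ _)) ⟩
  2 * (n * n ^ k)                  ≤⟨ *-monoˡ-≤ (n * n ^ k) 2≤n ⟩
  n * (n * n ^ k)                  ≡⟨ cong (n ^_) (cong suc (≡.sym (+-suc (length p) _))) ⟩
  n ^ (2 * suc (length p))         ∎
  where
  open ≤-Reasoning
  k : ℕ
  k = 2 * length p
  c≤ : c ≤ n * n ^ k
  c≤ = ≤-trans (≤-trans (m≤m+n c _) s≤n)
    (≤-trans (≤-reflexive (≡.sym (*-identityʳ n))) (*-monoʳ-≤ n (m^n>0 n {{>-nonZero (≤-trans (s≤s z≤n) 2≤n)}} k)))

double≤2^ : ∀ n → n + n ≤ 2 ^ n
double≤2^ zero    = z≤n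
double≤2^ (suc n) = ≤-trans (+-mono-≤ (n<2^n n) (n<2^n n)) (≤-reflexive (cong (2 ^ n +_) (≡.sym (+-identityʳ _))))

-- With n = tower s, tower (2 + s) ^ k is 2 to the power 2ⁿ * k, which is at
-- most 2 to the power 2ⁿ⁺ⁿ once k ≤ n.
tower-power : ∀ s k → k ≤ s → tower (2 + s) ^ k ≤ tower (3 + s)
tower-power s k k≤s = ≤-trans (≤-reflexive (^-*-assoc 2 (2 ^ tower s) k)) (^-monoʳ-≤ 2 (begin
  2 ^ tower s * k            ≤⟨ *-monoʳ-≤ (2 ^ tower s) (≤-trans k≤s (<⇒≤ (≤-trans (s<tower s) (<⇒≤ (n<2^n (tower s)))))) ⟩
  2 ^ tower s * 2 ^ tower s  ≡⟨ ≡.sym (^-distribˡ-+-* 2 (tower s) (tower s)) ⟩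
  2 ^ (tower s + tower s)    ≤⟨ ^-monoʳ-≤ 2 (double≤2^ (tower s)) ⟩
  2 ^ (2 ^ tower s)          ∎))
  where open ≤-Reasoning

tower-dominates : ∀ p s → 2 * length p + sum p ≤ s → eval p (tower (2 + s)) ≤ tower (3 + s)
tower-dominates p s big = ≤-trans
  (eval≤power p (tower (2 + s)) (≤-trans (s≤s (s≤s z≤n)) (<⇒≤ (s<tower (2 + s))))
    (≤-trans (m≤n+m _ (2 * length p)) (≤-trans big (≤-trans (m≤n+m s 2) (<⇒≤ (s<tower (2 + s)))))))
  (tower-power s (2 * length p) (≤-trans (m≤m+n _ _) big))

-- Counting the transducers caught in a block

count : (ℕ → Bool) → ℕ → ℕ
count p zero    = 0
count p (suc n) = if p n then suc (count p n) else count p n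

count-≤ : ∀ p n → count p n ≤ n
count-≤ p zero    = z≤n
count-≤ p (suc n) with p n
... | true  = s≤s (count-≤ p n)
... | false = ≤-trans (count-≤ p n) (n≤1+n n)

count-mono : ∀ p p' n → (∀ j → p j ≡ true → p' j ≡ true) → count p n ≤ count p' n
count-mono p p' zero    f = z≤n
count-mono p p' (suc n) f with p n in e
... | true rewrite f n e = s≤s (count-mono p p' n f)
... | false with p' n
... | true  = ≤-trans (count-mono p p' n f) (n≤1+n _)
... | false = count-mono p p' n f

count-strict : ∀ p p' n → (∀ j → p j ≡ true → p' j ≡ true) → ∀ j → j < n → p j ≡ false → p' j ≡ true →
  count p n < count p' n
count-strict p p' (suc n) f j j< e e' with j ≟ n
... | yes refl rewrite e | e' = s≤s (count-mono p p' n f)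
... | no j≢n with p n in en
... | true rewrite f n en = s≤s (count-strict p p' n f j (≤∧≢⇒< (≤-pred j<) j≢n) e e')
... | false with p' n
... | true  = ≤-trans (count-strict p p' n f j (≤∧≢⇒< (≤-pred j<) j≢n) e e') (n≤1+n _)
... | false = count-strict p p' n f j (≤∧≢⇒< (≤-pred j<) j≢n) e e'

Kills : ℕ → Set
Kills s = ∃[ j ] j < block s × dead 𝒪 j (stageLen (suc s)) ≡ true × dead 𝒪 j (stageLen s) ≡ false

-- A block has one more stage than there are machines that can die in it.
no-killing-block : ∀ d → (∀ s → block s ≡ d → Kills s) → ⊥
no-killing-block d always with diagonal-start d
... | n , e = <⇒≱ (≤-refl {suc d}) (≤-trans (grow (suc d) ≤-refl) (count-≤ _ d))
  where
  deaths : ℕ → ℕ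
  deaths s = count (λ j → dead 𝒪 j (stageLen s)) d
  in-block : ∀ b → b ≤ d → block (b + n) ≡ d
  in-block b b≤d = trans
    (cong (λ p → proj₁ p + proj₂ p) (unpair-diagonal n (d ∸ b) b (trans e (cong (_, 0) (≡.sym (m∸n+n≡m b≤d))))))
    (m∸n+n≡m b≤d)
  grow : ∀ b → b ≤ suc d → b ≤ deaths (b + n)
  grow zero    _   = z≤n
  grow (suc b) b<  with always (b + n) (in-block b (≤-pred b<))
  ... | j , j< , dies , alive = ≤-trans (s≤s (grow b (≤-trans (n≤1+n b) b<)))
    (count-strict _ _ d (λ i → dead-mono 𝒪 i (stageLen-mono (n≤1+n (b + n)))) j
      (subst (j <_) (in-block b (≤-pred b<)) j<) alive dies)

module NotOptimal (f : Word → Word) (optimal : Optimal 𝒪 (co (D 𝒪)) f) where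

  M : Machine
  M = proj₁ (proj₁ (proj₁ optimal))

  q : Poly
  q = proj₁ (proj₂ (proj₁ (proj₁ optimal)))

  computes : ComputesIn 𝒪 M q f
  computes = proj₂ (proj₂ (proj₁ (proj₁ optimal)))

  k : ℕ
  k = proj₁ (indexed M)

  Nk : N k ≡ M
  Nk = proj₁ (proj₂ (indexed M))

  -- At a refuted stage with target `k`, the machine of `f` would output an element of D. Hence
  -- `hg 𝒪 k` is a proof system, and `f` has to simulate it.
  not-refuted : ∀ s → target s ≡ k → ¬ Refuted s
  not-refuted s t (d , u , e) =
    proj₂ (proj₂ (proj₁ optimal) (hard s)) (u , transduce-computes q computes (target s) (trans (cong N t) Nk) (horizon s) u e) d

  simulation : Simulates f (hg 𝒪 k)
  simulation = proj₂ optimal (hg 𝒪 k) (hg-proofSystem k not-refuted)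

  translate : Word → Word
  translate = proj₁ simulation

  r : Poly
  r = proj₁ (proj₂ simulation)

  size : Polynomial (λ n → (1 + n) + (1 + ((n + 5) + 1)))
  size = (constant 1 ⊕ identity) ⊕ (constant 1 ⊕ ((identity ⊕ constant 5) ⊕ constant 1))

  work : Polynomial _
  -- The length of the translated proof plus the time of `f` on it, so that a single bound keeps
  -- both within the horizon.
  work = compose r size ⊕ compose q (compose r size)

  shortProof-length : ∀ s → ∣ shortProof s ∣ ≤ (1 + tower s) + (1 + ((tower s + 5) + 1))
  shortProof-length s = ≤-trans
    (≤-reflexive (trans (unary-length (suc s) _) (cong (λ l → suc s + suc l) (unary-length (witnessLen s) []))))
    (+-monoˡ-≤ _ (s≤s (<⇒≤ (s<tower s))))

  translate-length : ∀ s → ∣ translate (shortProof s) ∣ ≤ eval r ((1 + tower s) + (1 + ((tower s + 5) + 1)))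
  translate-length s = ≤-trans (proj₁ (proj₂ (proj₂ simulation) (shortProof s))) (eval-mono r (shortProof-length s))

  threshold : ℕ
  threshold = 2 + (2 * length (poly work) + sum (poly work))

  affordable : ∀ s → threshold ≤ s → eval (poly work) (tower s) ≤ horizon s
  affordable (suc (suc s)) (s≤s (s≤s p)) = ≤-trans (tower-dominates (poly work) s p)
    (≤-trans (m≤m+n _ 5) (m≤n+m _ 2))

  -- The translated short proof is a run of transducer `k` within the horizon that outputs `hard s`.
  -- This excludes waiting, and soundness of `f` excludes refutation; only a kill remains.
  kills-late : ∀ s → threshold ≤ s → target s ≡ k → Kills s
  kills-late s late t = go (outcome s (history s)) refl
    where
    u : Word
    u = translate (shortProof s)
    n : ℕ
    n = tower s
    total : eval r ((1 + n) + (1 + ((n + 5) + 1))) + eval q (eval r ((1 + n) + (1 + ((n + 5) + 1)))) ≤ horizon s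
    total = ≤-trans (≤-reflexive (≡.sym (evals work n))) (affordable s late)
    u≤ : ∣ u ∣ ≤ horizon s
    u≤ = ≤-trans (translate-length s) (≤-trans (m≤m+n _ _) total)
    proves : f u ≡ hard s
    proves = trans (proj₂ (proj₂ (proj₂ simulation) (shortProof s)))
      (trans (cong (λ k → hg 𝒪 k (shortProof s)) (≡.sym t)) (hg-shortProof 𝒪 s))
    found : transduce 𝒪 (target s) (horizon s) u ≡ just (hard s)
    found = trans (computes-transduce q computes (target s) (trans (cong N t) Nk) u
      (≤-trans (eval-mono q (translate-length s)) (≤-trans (m≤n+m _ _) total))) (cong just proves)
    go : ∀ {ws} → Outcome s (history s) ws → chosen s ≡ ws → Kills s
    go (kills j p j< dies alive) e = j , j< ,
      trans (dead-local j (stageLen (suc s)) (𝒪-chosen s e)) dies ,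
      trans (dead-local j (stageLen s) (below-weaken (<⇒≤ (stageLen-< s)) (𝒪-chosen s e))) alive
    go (refuted z₀ v len₀ t') e = ⊥-elim (not-refuted s t (refuted-stage s z₀ v len₀ e t'))
    go (waits never) e = ⊥-elim (never u u≤
      (trans (≡.sym (transduce-local (target s) (horizon s) u (𝒪-chosen s e))) found))

  contradiction : ⊥
  -- This block has target `k`, and it lies late enough because `threshold ≤ pair k threshold` and a
  -- stage is never smaller than the number of its block.
  contradiction = no-killing-block (pair k threshold) λ s e → kills-late s
    (≤-trans (snd≤pair k threshold) (≤-trans (≤-reflexive (≡.sym e)) (unpair-sum s)))
    (trans (cong (λ d → proj₁ (unpair d)) e) (cong proj₁ (unpair-pair k threshold)))

theorem38 : ∃[ O ] (∃[ f ] POptimal O (co (C O)) f) × ¬ (∃[ f ] Optimal O (co (D O)) f)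
theorem38 = 𝒪 , (hf 𝒪 , hf-proofSystem , hf-pSimulates) , λ (f , optimal) → NotOptimal.contradiction f optimal
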